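{- As $m$ and $k$ both tend to infinity (with no assumption on the relation between them), $$ch(K_{m*k})=(1+o(1))\,k\ln m,$$ i.e. for every $\varepsilon>0$ there is $N$ such that for all integers $m,k\ge N$, $(1-\varepsilon)k\ln m\le ch(K_{m*k})\le(1+\varepsilon)k\ln m$.
   Context: $K_{m*k}$ denotes the complete $k$-partite graph with $k$ color classes, each of size $m$. The choice number $ch(G)$ of a graph $G$ is the smallest integer $s$ such that for every assignment of a list of $s$ colors to each vertex of $G$ there is a proper coloring of $G$ assigning to each vertex a color from its list. -}

module Defs where

open import Data.Nat using (ℕ; zero; suc)
open import Data.Fin using (Fin)
open import Data.Product using (Σ; _×_; _,_; ∃)
open import Data.List using (List; length)
open import Data.List.Membership.Propositional using (_∈_)
open import Data.List.Relation.Unary.Unique.Propositional using (Unique)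
open import Data.Integer using (+_)
open import Data.Rational using (ℚ; 0ℚ; 1ℚ; _+_; _*_; _/_; _÷_; _≤_; ≢-nonZero)
open import Data.Rational.Properties using (_≟_)
open import Relation.Binary.PropositionalEquality using (_≡_; _≢_)
open import Relation.Nullary using (¬_; yes; no)

IsSAssignment : {V : Set} → ℕ → (V → List ℕ) → Set
IsSAssignment {V} s L = (v : V) → (length (L v) ≡ s) × Unique (L v)

ProperLColouring : {V : Set} → (V → V → Set) → (V → List ℕ) → (V → ℕ) → Set
ProperLColouring {V} Adj L f =
  ((v : V) → f v ∈ L v) × ((u v : V) → Adj u v → f u ≢ f v)

-- G is s-choosable: every s-list assignment admits a proper L-colouring.
-- ch(G) ≤ s  iff  Choosable Adj s  (choosability is upward closed), so
-- ch(G) is the least s with Choosable Adj s.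
Choosable : {V : Set} → (V → V → Set) → ℕ → Set
Choosable {V} Adj s =
  (L : V → List ℕ) → IsSAssignment s L → Σ (V → ℕ) (ProperLColouring Adj L)

KAdj : (m k : ℕ) → (Fin k × Fin m) → (Fin k × Fin m) → Set
KAdj m k (i , _) (i' , _) = i ≢ i'

ι : ℕ → ℚ
ι n = + n / 1

-- total division on ℚ (x / 0 := 0); only used with nonzero divisors
_÷'_ : ℚ → ℚ → ℚ
p ÷' q with q ≟ 0ℚ
... | yes _ = 0ℚ
... | no q≢0 = _÷_ p q {{≢-nonZero q≢0}}

expTerm : ℚ → ℕ → ℚ
expTerm x zero = 1ℚ
expTerm x (suc i) = expTerm x i * x * (+ 1 / suc i)

expPartial : ℚ → ℕ → ℚ
expPartial x zero = 0ℚ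
expPartial x (suc N) = expPartial x N + expTerm x N

-- For x ≥ 0 the partial sums increase to e^x, hence:
--   e^x ≤ M  iff  every partial sum is ≤ M
ExpLe : ℚ → ℚ → Set
ExpLe x M = (N : ℕ) → expPartial x N ≤ M

--   M ≤ e^x  iff  some partial sum is ≥ M
-- (the two readings agree: e^x = M with M ≥ 1 rational forces x = 0,
--  where the partial sum with N = 1 already equals 1)
GeExp : ℚ → ℚ → Set
GeExp M x = ∃ λ N → M ≤ expPartial x N

-- Comparisons of s with c·k·ln m for c > 0, k ≥ 1, m ≥ 1 (s ∈ ℕ):
--   s ≤ c·k·ln m  ⟺  e^{s/(c k)} ≤ m
--   c·k·ln m ≤ s  ⟺  m ≤ e^{s/(c k)}

LeCKlnM : ℕ → ℚ → ℕ → ℕ → Set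
LeCKlnM s c k m = ExpLe (ι s ÷' (c * ι k)) (ι m)

CKlnMLe : ℚ → ℕ → ℕ → ℕ → Set
CKlnMLe c k m s = GeExp (ι m) (ι s ÷' (c * ι k))

{-# OPTIONS --safe #-}
module Submission where

-- Upper bound.  If the colours are distributed at random over the k parts, a vertex with a list of s
-- colours is left without a colour of its own part with probability (1 - 1/k)^s, so the expected
-- number of failures is below 1 once s is slightly larger than k ln (k m).  This is (1 + o(1)) k ln m
-- for bounded k.  For larger k, parts and colours are first halved repeatedly, until a bounded (but
-- large) number of parts is left; in each halving every list keeps almost half of its colours, and
-- the relative losses form a telescoping product close to 1.
--
-- Lower bound.  For a large constant κ there are m sets of size s ≈ κ ln m in a set of (κ + 2) s points
-- such that no s points meet all of them; they are built greedily.  Replacing every point by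
-- r ≈ k / (κ + 2) copies and giving these m lists to the vertices of every part, each part uses more
-- than s colours, counted without copies, hence all parts together need more colours than there are.

open import Defs

-- No logarithm occurs in the combinatorial part; powers of 1 + 1/κ stand in for it. If (1 + 1/κ)^n
-- ≥ m then ln m ≤ n/κ, and if (1 + 1/κ)^n ≤ m then ln m ≥ n/(κ + 1). The two estimates differ by
-- the factor 1 + 1/κ, harmless for large κ. The combinatorics produces the same base: s points are
-- a fraction 1/(κ + 2) of the ground set in the lower bound, and colours are spread over κ + 1
-- parts in the upper bound, so in both cases ((κ + 1)/κ)^s is compared with m, up to lower order
-- factors.
--
-- The obstacle in the upper bound is the union bound over k m vertices: it costs ln k, which may
-- exceed ln m by any factor. Halving escapes it because the lists there have length at least of
-- order k, so that the deviation estimate for a single list beats k m. Read upwards, it doubles the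
-- number of parts, starting from a number bounded in terms of ε alone; hence the constants are
-- chosen before m and k.
--
-- Probabilities are replaced by sums of integer weights with all denominators cleared.

module ListColourings where

  open import Data.Nat
  open import Data.Nat.Properties
  open import Data.Nat.DivMod using (m≡m%n+[m/n]*n; m%n<n; m/n*n≤m)
  import Data.Nat.ListAction as ListAction
  open ListAction using (product)
  open import Data.Nat.Tactic.RingSolver using (solve-∀)
  open import Data.Bool using (if_then_else_; true; false)
  open import Data.Fin using (Fin; zero; suc; toℕ; fromℕ<; inject≤; quotient; remQuot; combine; finToFun; funToFin; punchIn)
  open import Data.Fin.Properties using (any?; toℕ<n; toℕ≤pred[n]; toℕ-injective; toℕ-fromℕ<; toℕ-inject≤; inject≤-injective; combine-remQuot; remQuot-combine; combine-injective; finToFun-funToFin; punchIn-injective; punchInᵢ≢i)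
  import Data.Fin.Properties as Fin
  open import Data.List using (List; []; _∷_; length; filter; take; upTo; map)
  import Data.List as List
  open import Data.List.Properties using (length-take; length-upTo; length-tabulate; take++drop≡id)
  open import Data.List.Membership.Propositional using (_∈_)
  open import Data.List.Membership.Propositional.Properties using (∈-++⁺ˡ; ∈-filter⁻; ∈-tabulate⁻)
  open import Data.List.Membership.DecPropositional _≟_ using (_∈?_)
  open import Data.List.Relation.Unary.Any using (here; there)
  open import Data.List.Relation.Unary.All using (All; []; _∷_; lookup; tabulate)
  open import Data.List.Relation.Unary.AllPairs using ([]; _∷_)
  open import Data.List.Relation.Unary.Unique.Propositional using (Unique)
  import Data.List.Relation.Unary.Unique.Propositional.Properties as Unique
  open import Data.Product using (_×_; _,_; ∃; proj₁; proj₂)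
  open import Data.Sum using (_⊎_; inj₁; inj₂)
  open import Data.Vec.Functional using (removeAt) renaming (_∷_ to _∷ᶠ_)
  open import Function using (_∘_; id; it)
  open import Function.Definitions using (Injective)
  open import Relation.Binary.PropositionalEquality
  open import Relation.Nullary
  open import Relation.Nullary.Decidable using (dec-true; dec-false; decidable-stable)
  open import Relation.Unary using (Decidable)
  import Algebra.Properties.Semiring.Sum +-*-semiring as Sum
  open Sum using (sum)

  -- Sums, averages and Bernoulli inequalities

  sum-mono : ∀ {n} {f g : Fin n → ℕ} → (∀ i → f i ≤ g i) → sum f ≤ sum g
  sum-mono {zero}  f≤g = z≤n
  sum-mono {suc n} f≤g = +-mono-≤ (f≤g zero) (sum-mono (f≤g ∘ suc))

  sum-const : ∀ n c → sum {n} (λ _ → c) ≡ n * c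
  sum-const zero    c = refl
  sum-const (suc n) c = cong (c +_) (sum-const n c)

  ≤sum : ∀ {n} (f : Fin n → ℕ) i → f i ≤ sum f
  ≤sum {suc n} f i rewrite Sum.sum-remove {i = i} f = m≤m+n (f i) _

  minimum : ∀ {n} (f : Fin (suc n) → ℕ) → ∃ λ i → ∀ j → f i ≤ f j
  minimum {zero} f = zero , λ { zero → ≤-refl }
  minimum {suc n} f with minimum (f ∘ suc)
  ... | i , f[i]≤ with ≤-total (f zero) (f (suc i))
  ... | inj₁ f0≤ = zero , λ { zero → ≤-refl ; (suc j) → ≤-trans f0≤ (f[i]≤ j) }
  ... | inj₂ ≤f0 = suc i , λ { zero → ≤f0 ; (suc j) → f[i]≤ j }

  maximum : ∀ {n} (f : Fin (suc n) → ℕ) → ∃ λ i → ∀ j → f j ≤ f i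
  maximum {zero} f = zero , λ { zero → ≤-refl }
  maximum {suc n} f with maximum (f ∘ suc)
  ... | i , ≤f[i] with ≤-total (f zero) (f (suc i))
  ... | inj₁ f0≤ = suc i , λ { zero → f0≤ ; (suc j) → ≤f[i] j }
  ... | inj₂ ≤f0 = zero , λ { zero → ≤-refl ; (suc j) → ≤-trans (≤f[i] j) ≤f0 }

  below-average : ∀ {n} (f : Fin (suc n) → ℕ) → ∃ λ i → suc n * f i ≤ sum f
  below-average {n} f with minimum f
  ... | i , f[i]≤ = i , subst (_≤ sum f) (sum-const (suc n) (f i)) (sum-mono f[i]≤)

  above-average : ∀ {n} (f : Fin (suc n) → ℕ) → ∃ λ i → sum f ≤ suc n * f i
  above-average {n} f with maximum f
  ... | i , ≤f[i] = i , subst (sum f ≤_) (sum-const (suc n) (f i)) (sum-mono ≤f[i])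

  -- Applied to comparisons involving powers, where the crossing point plays the role of the integer
  -- part of a logarithm.
  threshold : ∀ {P : ℕ → Set} → Decidable P → ∀ {n} → ¬ P 0 → P n → ∃ λ p → ¬ P p × P (suc p)
  threshold P? {zero} ¬P0 Pn = contradiction Pn ¬P0
  threshold P? {suc n} ¬P0 Pn with P? n
  ... | yes Pn′ = threshold P? ¬P0 Pn′
  ... | no ¬Pn = n , ¬Pn , Pn

  ^-distribʳ-* : ∀ n a b → (a * b) ^ n ≡ a ^ n * b ^ n
  ^-distribʳ-* zero a b = refl
  ^-distribʳ-* (suc n) a b rewrite ^-distribʳ-* n a b = lemma a b (a ^ n) (b ^ n)
    where
    lemma : ∀ a b c d → a * b * (c * d) ≡ a * c * (b * d)
    lemma = solve-∀

  ^-cancelˡ-≤ : ∀ n a b → a ^ suc n ≤ b ^ suc n → a ≤ b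
  ^-cancelˡ-≤ n a b aⁿ≤bⁿ = ≮⇒≥ λ b<a → <⇒≱ (^-monoˡ-< (suc n) b<a) aⁿ≤bⁿ

  -- Bernoulli's inequality (1 + 1/κ)^w ≥ 1 + w/κ, multiplied by κ^(w+1).
  bernoulli : ∀ κ w → κ ^ w * (κ + w) ≤ suc κ ^ w * κ
  bernoulli κ zero = ≤-reflexive (cong (1 *_) (+-identityʳ κ))
  bernoulli κ (suc w) = begin
    κ * κ ^ w * (κ + suc w)      ≤⟨ m≤m+n _ (κ ^ w * w) ⟩
    κ * κ ^ w * (κ + suc w) + κ ^ w * w ≡⟨ lemma κ (κ ^ w) w ⟩
    suc κ * (κ ^ w * (κ + w))    ≤⟨ *-monoʳ-≤ (suc κ) (bernoulli κ w) ⟩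
    suc κ * (suc κ ^ w * κ)      ≡⟨ *-assoc (suc κ) (suc κ ^ w) κ ⟨
    suc κ * suc κ ^ w * κ        ∎
    where
    open ≤-Reasoning
    lemma : ∀ κ c w → κ * c * (κ + suc w) + c * w ≡ suc κ * (c * (κ + w))
    lemma = solve-∀

  -- Bernoulli's inequality (1 - x)^w ≥ 1 - w x at x = 1/(κ + 1), with denominators cleared and the
  -- subtracted term moved to the other side.
  bernoulli-decreasing : ∀ κ w → suc κ ^ w * suc κ ≤ κ ^ w * suc κ + w * suc κ ^ w
  bernoulli-decreasing κ zero = m≤m+n _ 0
  bernoulli-decreasing κ (suc w) = begin
    suc κ * suc κ ^ w * suc κ    ≡⟨ *-assoc (suc κ) (suc κ ^ w) (suc κ) ⟩
    suc κ * (suc κ ^ w * suc κ)  ≤⟨ *-monoʳ-≤ (suc κ) (bernoulli-decreasing κ w) ⟩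
    suc κ * (κ ^ w * suc κ + w * suc κ ^ w) ≡⟨ lemma κ (κ ^ w) w (suc κ ^ w) ⟩
    κ * κ ^ w * suc κ + w * (suc κ * suc κ ^ w) + κ ^ w * suc κ
      ≤⟨ +-monoʳ-≤ (κ * κ ^ w * suc κ + w * (suc κ * suc κ ^ w)) (*-monoˡ-≤ (suc κ) (^-monoˡ-≤ w (n≤1+n κ))) ⟩
    κ * κ ^ w * suc κ + w * (suc κ * suc κ ^ w) + suc κ ^ w * suc κ ≡⟨ lemma′ (κ * κ ^ w) (suc κ) w (suc κ ^ w) ⟩
    κ * κ ^ w * suc κ + suc w * (suc κ * suc κ ^ w) ∎
    where
    open ≤-Reasoning
    lemma : ∀ κ c w e → suc κ * (c * suc κ + w * e) ≡ κ * c * suc κ + w * (suc κ * e) + c * suc κ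
    lemma = solve-∀
    lemma′ : ∀ c κ w e → c * κ + w * (κ * e) + e * κ ≡ c * κ + suc w * (κ * e)
    lemma′ = solve-∀

  double-pow : ∀ κ w → .{{NonZero κ}} → κ ≤ w → 2 * κ ^ w ≤ suc κ ^ w
  double-pow κ w κ≤w = *-cancelʳ-≤ _ _ κ (begin
    2 * κ ^ w * κ    ≡⟨ lemma κ (κ ^ w) ⟩
    κ ^ w * (κ + κ)  ≤⟨ *-monoʳ-≤ (κ ^ w) (+-monoʳ-≤ κ κ≤w) ⟩
    κ ^ w * (κ + w)  ≤⟨ bernoulli κ w ⟩
    suc κ ^ w * κ    ∎)
    where
    open ≤-Reasoning
    lemma : ∀ κ c → 2 * c * κ ≡ c * (κ + κ)
    lemma = solve-∀

  double-pow-iterate : ∀ κ w u → .{{NonZero κ}} → κ ≤ w → 2 ^ u * κ ^ (w * u) ≤ suc κ ^ (w * u)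
  double-pow-iterate κ w u κ≤w = begin
    2 ^ u * κ ^ (w * u)    ≡⟨ cong (2 ^ u *_) (^-*-assoc κ w u) ⟨
    2 ^ u * (κ ^ w) ^ u    ≡⟨ ^-distribʳ-* u 2 (κ ^ w) ⟨
    (2 * κ ^ w) ^ u        ≤⟨ ^-monoˡ-≤ u (double-pow κ w κ≤w) ⟩
    (suc κ ^ w) ^ u        ≡⟨ ^-*-assoc (suc κ) w u ⟩
    suc κ ^ (w * u)        ∎
    where open ≤-Reasoning

  pow-half : ∀ κ w → 2 * w ≤ suc κ → suc κ ^ w ≤ 2 * κ ^ w
  pow-half κ w 2w≤ = *-cancelʳ-≤ _ _ (suc κ) (+-cancelˡ-≤ (suc κ ^ w * suc κ) _ _ (begin
    suc κ ^ w * suc κ + suc κ ^ w * suc κ ≤⟨ +-mono-≤ (bernoulli-decreasing κ w) (bernoulli-decreasing κ w) ⟩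
    (κ ^ w * suc κ + w * suc κ ^ w) + (κ ^ w * suc κ + w * suc κ ^ w) ≡⟨ lemma (κ ^ w) (suc κ) w (suc κ ^ w) ⟩
    suc κ ^ w * (2 * w) + 2 * κ ^ w * suc κ ≤⟨ +-monoˡ-≤ _ (*-monoʳ-≤ (suc κ ^ w) 2w≤) ⟩
    suc κ ^ w * suc κ + 2 * κ ^ w * suc κ ∎))
    where
    open ≤-Reasoning
    lemma : ∀ c κ w e → (c * κ + w * e) + (c * κ + w * e) ≡ e * (2 * w) + 2 * c * κ
    lemma = solve-∀

  -- A substitute for (1 + 1/κ)^κ ≤ e: the exponent is cut into halves short enough for `pow-half`,
  -- each contributing at most a factor 2.
  pow-quarter : ∀ κ → suc κ ^ κ ≤ 4 * κ ^ κ
  pow-quarter κ = begin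
    suc κ ^ κ                     ≡⟨ cong (suc κ ^_) (⌊n/2⌋+⌈n/2⌉≡n κ) ⟨
    suc κ ^ (a + b)               ≡⟨ ^-distribˡ-+-* (suc κ) a b ⟩
    suc κ ^ a * suc κ ^ b         ≤⟨ *-mono-≤ (pow-half κ a 2a≤) (pow-half κ b 2b≤) ⟩
    2 * κ ^ a * (2 * κ ^ b)       ≡⟨ lemma (κ ^ a) (κ ^ b) ⟩
    4 * (κ ^ a * κ ^ b)           ≡⟨ cong (4 *_) (^-distribˡ-+-* κ a b) ⟨
    4 * κ ^ (a + b)               ≡⟨ cong (λ z → 4 * κ ^ z) (⌊n/2⌋+⌈n/2⌉≡n κ) ⟩
    4 * κ ^ κ                     ∎
    where
    open ≤-Reasoning
    a = ⌊ κ /2⌋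
    b = ⌈ κ /2⌉
    double-⌊/2⌋ : ∀ n → 2 * ⌊ n /2⌋ ≤ n
    double-⌊/2⌋ n = subst₂ _≤_ (cong (⌊ n /2⌋ +_) (sym (+-identityʳ _))) (⌊n/2⌋+⌈n/2⌉≡n n) (+-monoʳ-≤ ⌊ n /2⌋ (⌊n/2⌋≤⌈n/2⌉ n))
    2a≤ : 2 * a ≤ suc κ
    2a≤ = m≤n⇒m≤1+n (double-⌊/2⌋ κ)
    2b≤ : 2 * b ≤ suc κ
    2b≤ = double-⌊/2⌋ (suc κ)
    lemma : ∀ c e → 2 * c * (2 * e) ≡ 4 * (c * e)
    lemma = solve-∀

  pow-ratio≤4^ : ∀ κ s u → s ≤ κ * u → suc κ ^ s ≤ 4 ^ u * κ ^ s
  pow-ratio≤4^ κ s u s≤ with m≤n⇒∃[o]m+o≡n s≤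
  ... | z , eq = *-cancelʳ-≤ _ _ (suc κ ^ z) {{m^n≢0 (suc κ) z}} (begin
    suc κ ^ s * suc κ ^ z    ≡⟨ ^-distribˡ-+-* (suc κ) s z ⟨
    suc κ ^ (s + z)          ≡⟨ cong (suc κ ^_) eq ⟩
    suc κ ^ (κ * u)          ≡⟨ ^-*-assoc (suc κ) κ u ⟨
    (suc κ ^ κ) ^ u          ≤⟨ ^-monoˡ-≤ u (pow-quarter κ) ⟩
    (4 * κ ^ κ) ^ u          ≡⟨ ^-distribʳ-* u 4 (κ ^ κ) ⟩
    4 ^ u * (κ ^ κ) ^ u      ≡⟨ cong (4 ^ u *_) (^-*-assoc κ κ u) ⟩
    4 ^ u * κ ^ (κ * u)      ≡⟨ cong (λ e → 4 ^ u * κ ^ e) eq ⟨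
    4 ^ u * κ ^ (s + z)      ≡⟨ cong (4 ^ u *_) (^-distribˡ-+-* κ s z) ⟩
    4 ^ u * (κ ^ s * κ ^ z)  ≡⟨ *-assoc (4 ^ u) (κ ^ s) (κ ^ z) ⟨
    4 ^ u * κ ^ s * κ ^ z    ≤⟨ *-monoʳ-≤ (4 ^ u * κ ^ s) (^-monoˡ-≤ z (n≤1+n κ)) ⟩
    4 ^ u * κ ^ s * suc κ ^ z ∎)
    where open ≤-Reasoning

  -- Upper bound: partitions of the colours by conditional expectations

  ∏< : ℕ → (ℕ → ℕ) → ℕ
  ∏< zero    f = 1
  ∏< (suc n) f = f 0 * ∏< n (f ∘ suc)

  ∏<-cong : ∀ n {f g : ℕ → ℕ} → (∀ x → f x ≡ g x) → ∏< n f ≡ ∏< n g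
  ∏<-cong zero    f≗g = refl
  ∏<-cong (suc n) f≗g = cong₂ _*_ (f≗g 0) (∏<-cong n (f≗g ∘ suc))

  ∏<-extract : ∀ n {y c} {f g : ℕ → ℕ} → y < n → f y ≡ c * g y → (∀ x → x ≢ y → f x ≡ g x) →
               ∏< n f ≡ c * ∏< n g
  ∏<-extract (suc n) {zero} {c} {f} {g} y<n fy≡ f≡g = begin
    f 0 * ∏< n (f ∘ suc)        ≡⟨ cong₂ _*_ fy≡ (∏<-cong n λ x → f≡g (suc x) λ ()) ⟩
    c * g 0 * ∏< n (g ∘ suc)    ≡⟨ *-assoc c (g 0) _ ⟩
    c * (g 0 * ∏< n (g ∘ suc))  ∎
    where open ≡-Reasoning
  ∏<-extract (suc n) {suc y} {c} {f} {g} (s≤s y<n) fy≡ f≡g = begin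
    f 0 * ∏< n (f ∘ suc)        ≡⟨ cong₂ _*_ (f≡g 0 λ ()) (∏<-extract n {c = c} y<n fy≡ λ x x≢y → f≡g (suc x) (x≢y ∘ suc-injective)) ⟩
    g 0 * (c * ∏< n (g ∘ suc))  ≡⟨ lemma (g 0) c (∏< n (g ∘ suc)) ⟩
    c * (g 0 * ∏< n (g ∘ suc))  ∎
    where
    open ≡-Reasoning
    lemma : ∀ a b c → a * (b * c) ≡ b * (a * c)
    lemma = solve-∀

  -- Factors 1 off the list turn a product over a list into a product over all colours below a
  -- common bound, so that the colours can be placed in one order for all vertices at once.
  restrict : List ℕ → (ℕ → ℕ) → ℕ → ℕ
  restrict l g x = if does (x ∈? l) then g x else 1

  ∏<-restrict : ∀ n l g → Unique l → All (_< n) l → ∏< n (restrict l g) ≡ product (map g l)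
  ∏<-restrict n [] g _ _ = ones n
    where
    ones : ∀ n → ∏< n (λ _ → 1) ≡ 1
    ones zero    = refl
    ones (suc n) = trans (*-identityˡ _) (ones n)
  ∏<-restrict n (y ∷ l) g (y∉l ∷ unique) (y<n ∷ l<n) =
    trans (∏<-extract n {c = g y} y<n at-y off-y) (cong (g y *_) (∏<-restrict n l g unique l<n))
    where
    at-y : restrict (y ∷ l) g y ≡ g y * restrict l g y
    at-y rewrite dec-true (y ∈? (y ∷ l)) (here refl) | dec-false (y ∈? l) (λ y∈l → lookup y∉l y∈l refl) = sym (*-identityʳ (g y))
    off-y : ∀ x → x ≢ y → restrict (y ∷ l) g x ≡ restrict l g x
    off-y x x≢y rewrite dec-false (x ≟ y) x≢y = refl

  -- The method of conditional expectations for a uniformly random χ : F x v (χ x) are the random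
  -- factors, G x v bounds their mean.
  derandomise : ∀ n {N q} (F : ℕ → Fin N → Fin (suc q) → ℕ) (G : ℕ → Fin N → ℕ) →
                (∀ x v → sum (F x v) ≤ suc q * G x v) → (c : Fin N → ℕ) →
                ∃ λ (χ : ℕ → Fin (suc q)) →
                  sum (λ v → c v * ∏< n (λ x → F x v (χ x))) ≤ sum (λ v → c v * ∏< n (λ x → G x v))
  derandomise zero F G mean c = (λ _ → zero) , ≤-refl
  -- The value at colour 0 is chosen with all later factors replaced by their bounds `G`; the factor
  -- thus fixed is then absorbed into the weight `c`.
  derandomise (suc n) {N} {q} F G mean c with below-average (λ j → sum (λ v → c v * F 0 v j * ∏< n (λ x → G (suc x) v)))
  ... | j , j-below with derandomise n (F ∘ suc) (G ∘ suc) (mean ∘ suc) (λ v → c v * F 0 v j)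
  ... | χ , IH = (λ { zero → j ; (suc x) → χ x }) , (begin
    sum (λ v → c v * (F 0 v j * P v))    ≡⟨ Sum.sum-cong-≗ (λ v → sym (*-assoc (c v) (F 0 v j) (P v))) ⟩
    sum (λ v → c v * F 0 v j * P v)      ≤⟨ IH ⟩
    sum (λ v → c v * F 0 v j * R v)      ≤⟨ *-cancelˡ-≤ (suc q) scaled ⟩
    sum (λ v → c v * (G 0 v * R v))      ∎)
    where
    open ≤-Reasoning
    P R : Fin N → ℕ
    P v = ∏< n (λ x → F (suc x) v (χ x))
    R v = ∏< n (λ x → G (suc x) v)
    reorder : ∀ a b c → a * b * c ≡ a * c * b
    reorder = solve-∀
    reorder′ : ∀ a b c q → a * c * (q * b) ≡ q * (a * (b * c))
    reorder′ = solve-∀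
    scaled : suc q * sum (λ v → c v * F 0 v j * R v) ≤ suc q * sum (λ v → c v * (G 0 v * R v))
    scaled = begin
      suc q * sum (λ v → c v * F 0 v j * R v)         ≤⟨ j-below ⟩
      sum (λ i → sum (λ v → c v * F 0 v i * R v))     ≡⟨ Sum.∑-comm (λ i v → c v * F 0 v i * R v) ⟩
      sum (λ v → sum (λ i → c v * F 0 v i * R v))
        ≡⟨ Sum.sum-cong-≗ (λ v → trans (Sum.sum-cong-≗ (λ i → reorder (c v) (F 0 v i) (R v))) (sym (Sum.*-distribˡ-sum (c v * R v) (F 0 v)))) ⟩
      sum (λ v → c v * R v * sum (F 0 v))             ≤⟨ sum-mono (λ v → *-monoʳ-≤ (c v * R v) (mean 0 v)) ⟩
      sum (λ v → c v * R v * (suc q * G 0 v))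
        ≡⟨ Sum.sum-cong-≗ (λ v → reorder′ (c v) (G 0 v) (R v) (suc q)) ⟩
      sum (λ v → suc q * (c v * (G 0 v * R v)))       ≡⟨ Sum.*-distribˡ-sum (suc q) (λ v → c v * (G 0 v * R v)) ⟨
      suc q * sum (λ v → c v * (G 0 v * R v))         ∎

  sum-indicator : ∀ {q} (σ : Fin (suc q)) A B → sum (λ j → if does (j Fin.≟ σ) then A else B) ≡ A + q * B
  sum-indicator {q} zero A B = cong (A +_) (sum-const q B)
  sum-indicator {suc q} (suc σ) A B = begin
    B + sum (λ j → if does (j Fin.≟ σ) then A else B)  ≡⟨ cong (B +_) (sum-indicator σ A B) ⟩
    B + (A + q * B)                                    ≡⟨ lemma A B (q * B) ⟩
    A + suc q * B                                      ∎
    where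
    open ≡-Reasoning
    lemma : ∀ a b c → b + (a + c) ≡ a + (b + c)
    lemma = solve-∀

  product-const : ∀ c l → product (map (λ (_ : ℕ) → c) l) ≡ c ^ length l
  product-const c [] = refl
  product-const c (x ∷ l) = cong (c *_) (product-const c l)

  matching : ∀ {q} → (ℕ → Fin q) → Fin q → List ℕ → List ℕ
  matching χ σ = filter (λ x → χ x Fin.≟ σ)

  product-matching : ∀ {q} (χ : ℕ → Fin q) σ r a b l →
    ∃ λ z → length (matching χ σ l) + z ≡ length l ×
            product (map (λ x → if does (χ x Fin.≟ σ) then r * a else r * b) l) ≡
            r ^ length l * (a ^ length (matching χ σ l) * b ^ z)
  product-matching χ σ r a b [] = 0 , refl , refl
  product-matching χ σ r a b (x ∷ l) with product-matching χ σ r a b l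
  ... | z , len , prod with χ x Fin.≟ σ
  ... | yes _ = z , cong suc len , trans (cong (r * a *_) prod) (lemma r a (r ^ length l) (a ^ length (matching χ σ l)) (b ^ z))
    where
    lemma : ∀ r a c d e → r * a * (c * (d * e)) ≡ r * c * (a * d * e)
    lemma = solve-∀
  ... | no _ = suc z , trans (+-suc _ z) (cong suc len) , trans (cong (r * b *_) prod) (lemma r b (r ^ length l) (a ^ length (matching χ σ l)) (b ^ z))
    where
    lemma : ∀ r b c d e → r * b * (c * (d * e)) ≡ r * c * (d * (b * e))
    lemma = solve-∀

  ≤-list-sum : ∀ {x l} → x ∈ l → x ≤ ListAction.sum l
  ≤-list-sum {l = y ∷ l} (here refl) = m≤m+n y _
  ≤-list-sum {l = y ∷ l} (there x∈l) = ≤-trans (≤-list-sum x∈l) (m≤n+m _ y)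

  -- Chernoff's argument. Since a ≤ b, a list with at most `s` colours in its own class would have
  -- weight at least (q+1)^(s+w) a^s b^w, which exceeds the expected total weight N (a + q b)^(s+w)
  -- of all lists.
  balanced-partition : ∀ {N} q s w a b → a ≤ b →
    N * (a + q * b) ^ (s + w) < suc q ^ (s + w) * (a ^ s * b ^ w) →
    (L : Fin N → List ℕ) → IsSAssignment (s + w) L → (σ : Fin N → Fin (suc q)) →
    ∃ λ χ → ∀ v → s < length (matching χ (σ v) (L v))
  balanced-partition {N} q s w a b a≤b small L assign σ = χ , many
    where
    open ≤-Reasoning
    A = a + q * b
    n = suc (sum (λ v → ListAction.sum (L v)))
    L<n : ∀ v → All (_< n) (L v)
    L<n v = tabulate λ x∈ → s≤s (≤-trans (≤-list-sum x∈) (≤sum (λ v → ListAction.sum (L v)) v))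
    -- The common factor `suc q` makes the mean weight of a colour the integer `A`.
    factor : Fin N → Fin (suc q) → ℕ
    factor v j = if does (j Fin.≟ σ v) then suc q * a else suc q * b
    F : ℕ → Fin N → Fin (suc q) → ℕ
    F x v j = restrict (L v) (λ _ → factor v j) x
    G : ℕ → Fin N → ℕ
    G x v = restrict (L v) (λ _ → A) x
    mean : ∀ x v → sum (F x v) ≤ suc q * G x v
    mean x v with x ∈? L v
    ... | yes _ = ≤-reflexive (trans (sum-indicator (σ v) (suc q * a) (suc q * b)) (lemma q a b))
      where
      lemma : ∀ q a b → suc q * a + q * (suc q * b) ≡ suc q * (a + q * b)
      lemma = solve-∀
    ... | no _ = ≤-reflexive (sum-const (suc q) 1)
    chosen = derandomise n F G mean (λ _ → 1)
    χ = proj₁ chosen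
    bound : ∀ v → product (map (λ x → factor v (χ x)) (L v)) ≤ N * A ^ (s + w)
    bound v = begin
      product (map (λ x → factor v (χ x)) (L v))   ≡⟨ ∏<-restrict n (L v) _ (proj₂ (assign v)) (L<n v) ⟨
      ∏< n (λ x → F x v (χ x))                     ≡⟨ *-identityˡ _ ⟨
      1 * ∏< n (λ x → F x v (χ x))                 ≤⟨ ≤sum (λ v → 1 * ∏< n (λ x → F x v (χ x))) v ⟩
      sum (λ v → 1 * ∏< n (λ x → F x v (χ x)))     ≤⟨ proj₂ chosen ⟩
      sum (λ v → 1 * ∏< n (λ x → G x v))           ≡⟨ Sum.sum-cong-≗ total ⟩
      sum {N} (λ _ → A ^ (s + w))                  ≡⟨ sum-const N _ ⟩
      N * A ^ (s + w)                              ∎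
      where
      total : ∀ v → 1 * ∏< n (λ x → G x v) ≡ A ^ (s + w)
      total v = trans (*-identityˡ _) (trans (∏<-restrict n (L v) _ (proj₂ (assign v)) (L<n v))
        (trans (product-const A (L v)) (cong (A ^_) (proj₁ (assign v)))))
    many : ∀ v → s < length (matching χ (σ v) (L v))
    many v = ≰⇒> λ few → <⇒≱ small (begin
      suc q ^ (s + w) * (a ^ s * b ^ w)                ≤⟨ *-monoʳ-≤ (suc q ^ (s + w)) (fewer few) ⟩
      suc q ^ (s + w) * (a ^ μ * b ^ z)                ≡⟨ cong (λ e → suc q ^ e * (a ^ μ * b ^ z)) (proj₁ (assign v)) ⟨
      suc q ^ length (L v) * (a ^ μ * b ^ z)           ≡⟨ proj₂ (proj₂ counts) ⟨
      product (map (λ x → factor v (χ x)) (L v))       ≤⟨ bound v ⟩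
      N * A ^ (s + w)                                  ∎)
      where
      counts = product-matching χ (σ v) (suc q) a b (L v)
      z = proj₁ counts
      μ = length (matching χ (σ v) (L v))
      μ+z : μ + z ≡ s + w
      μ+z = trans (proj₁ (proj₂ counts)) (proj₁ (assign v))
      fewer : μ ≤ s → a ^ s * b ^ w ≤ a ^ μ * b ^ z
      fewer μ≤s with m≤n⇒∃[o]m+o≡n μ≤s
      ... | o , μ+o≡s = begin
        a ^ s * b ^ w              ≡⟨ cong (λ e → a ^ e * b ^ w) μ+o≡s ⟨
        a ^ (μ + o) * b ^ w        ≡⟨ cong (_* b ^ w) (^-distribˡ-+-* a μ o) ⟩
        a ^ μ * a ^ o * b ^ w      ≡⟨ *-assoc (a ^ μ) (a ^ o) (b ^ w) ⟩
        a ^ μ * (a ^ o * b ^ w)    ≤⟨ *-monoʳ-≤ (a ^ μ) (*-monoˡ-≤ (b ^ w) (^-monoˡ-≤ o a≤b)) ⟩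
        a ^ μ * (b ^ o * b ^ w)    ≡⟨ cong (a ^ μ *_) (^-distribˡ-+-* b o w) ⟨
        a ^ μ * b ^ (o + w)        ≡⟨ cong (λ e → a ^ μ * b ^ e) (+-cancelˡ-≡ μ _ _ (trans (sym (+-assoc μ o w)) (trans (cong (_+ w) μ+o≡s) (sym μ+z)))) ⟩
        a ^ μ * b ^ z              ∎

  ∈-take⁻ : ∀ {x : ℕ} n {l} → x ∈ take n l → x ∈ l
  ∈-take⁻ {x} n {l} x∈ = subst (x ∈_) (take++drop≡id n l) (∈-++⁺ˡ x∈)

  length-take-≤ : ∀ {n} (l : List ℕ) → n ≤ length l → length (take n l) ≡ n
  length-take-≤ {n} l n≤ = trans (length-take n l) (m≤n⇒m⊓n≡m n≤)

  -- Each group of `k` parts uses only the colours of its own class, so different groups never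
  -- clash, and within a group the `suc s` surviving colours of each list suffice.
  choosable-split : ∀ {m k} q s w a b → a ≤ b →
    suc q * k * m * (a + q * b) ^ (s + w) < suc q ^ (s + w) * (a ^ s * b ^ w) →
    Choosable (KAdj m k) (suc s) → Choosable (KAdj m (suc q * k)) (s + w)
  choosable-split {m} {k} q s w a b a≤b small choosable L assign = f , f∈L , f-proper
    where
    group : Fin (suc q * k) → Fin (suc q)
    group = quotient {suc q} k
    member : Fin (suc q * k) → Fin k
    member i = proj₂ (remQuot {suc q} k i)
    L-linear : Fin (suc q * k * m) → List ℕ
    L-linear = L ∘ remQuot m
    partition = balanced-partition q s w a b a≤b small L-linear (assign ∘ remQuot m) (λ p → group (proj₁ (remQuot {suc q * k} m p)))
    χ = proj₁ partition
    many : ∀ i j → s < length (matching χ (group i) (L (i , j)))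
    many i j = subst (λ v → s < length (matching χ (group (proj₁ v)) (L v))) (remQuot-combine i j) (proj₂ partition (combine i j))
    many′ : ∀ g i j → s < length (matching χ g (L (combine g i , j)))
    many′ g i j = subst (λ h → s < length (matching χ h (L (combine g i , j)))) (cong proj₁ (remQuot-combine g i)) (many (combine g i) j)
    -- Truncated because `Choosable` speaks of lists of one exact length.
    L′ : Fin (suc q) → Fin k × Fin m → List ℕ
    L′ g (i , j) = take (suc s) (matching χ g (L (combine g i , j)))
    colouring : ∀ g → _
    colouring g = choosable (L′ g) λ (i , j) → length-take-≤ (matching χ g (L (combine g i , j))) (many′ g i j) ,
      Unique.take⁺ (suc s) (Unique.filter⁺ (λ x → χ x Fin.≟ g) (proj₂ (assign (combine g i , j))))
    f : Fin (suc q * k) × Fin m → ℕ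
    f (i , j) = proj₁ (colouring (group i)) (member i , j)
    f∈matching : ∀ i j → f (i , j) ∈ matching χ (group i) (L (combine (group i) (member i) , j))
    f∈matching i j = ∈-take⁻ (suc s) (proj₁ (proj₂ (colouring (group i))) (member i , j))
    f∈L : ∀ v → f v ∈ L v
    f∈L (i , j) = subst (λ i′ → f (i , j) ∈ L (i′ , j)) (combine-remQuot {suc q} k i)
      (proj₁ (∈-filter⁻ (λ x → χ x Fin.≟ group i) (f∈matching i j)))
    χ-f : ∀ i j → χ (f (i , j)) ≡ group i
    χ-f i j = proj₂ (∈-filter⁻ (λ x → χ x Fin.≟ group i) {xs = L (combine (group i) (member i) , j)} (f∈matching i j))
    f-proper : ∀ u v → KAdj m (suc q * k) u v → f u ≢ f v
    f-proper (i , j) (i′ , j′) i≢i′ fu≡fv = proj₂ (proj₂ (colouring (group i))) (member i , j) (member i′ , j′)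
      (λ member≡ → i≢i′ (trans (sym (combine-remQuot {suc q} k i)) (trans (cong₂ combine group≡ member≡) (combine-remQuot {suc q} k i′))))
      (trans fu≡fv (cong (λ g → proj₁ (colouring g) (member i′ , j′)) (sym group≡)))
      where
      group≡ : group i ≡ group i′
      group≡ = trans (sym (χ-f i j)) (trans (cong χ fu≡fv) (χ-f i′ j′))

  -- Monotonicity of choosability

  choosable-mono-lists : ∀ {m k s s′} → s ≤ s′ → Choosable (KAdj m k) s → Choosable (KAdj m k) s′
  choosable-mono-lists {s = s} s≤s′ choosable L assign with choosable (take s ∘ L)
    (λ v → length-take-≤ (L v) (subst (s ≤_) (sym (proj₁ (assign v))) s≤s′) , Unique.take⁺ s (proj₂ (assign v)))
  ... | f , f∈ , proper = f , ∈-take⁻ s ∘ f∈ , proper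

  choosable-antimono-parts : ∀ {m k k′ s} → k ≤ k′ → Choosable (KAdj m k′) s → Choosable (KAdj m k) s
  choosable-antimono-parts {m} {k} {k′} {s} k≤k′ choosable L assign with choosable L′ assign′
    where
    L′ : Fin k′ × Fin m → List ℕ
    L′ (i , j) with toℕ i <? k
    ... | yes i<k = L (fromℕ< i<k , j)
    -- The added parts receive arbitrary lists; their colours are discarded.
    ... | no _ = upTo s
    assign′ : IsSAssignment s L′
    assign′ (i , j) with toℕ i <? k
    ... | yes i<k = assign (fromℕ< i<k , j)
    ... | no _ = length-upTo s , Unique.upTo⁺ s
  ... | f , f∈ , proper = (λ (i , j) → f (inject≤ i k≤k′ , j)) , f∈L ,
    λ (i , j) (i′ , j′) i≢i′ → proper _ _ (i≢i′ ∘ inject≤-injective k≤k′ k≤k′ i i′)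
    where
    f∈L : ∀ v → f (inject≤ (proj₁ v) k≤k′ , proj₂ v) ∈ L v
    f∈L (i , j) with toℕ (inject≤ i k≤k′) <? k | f∈ (inject≤ i k≤k′ , j)
    ... | yes i<k | f∈′ = subst (λ i′ → f (inject≤ i k≤k′ , j) ∈ L (i′ , j))
      (toℕ-injective (trans (toℕ-fromℕ< i<k) (toℕ-inject≤ i k≤k′))) f∈′
    ... | no i≮k | _ = contradiction (subst (_< k) (sym (toℕ-inject≤ i k≤k′)) (toℕ<n i)) i≮k

  -- Lower bound: hypergraphs without small hitting sets

  ∏ : ∀ {n} → (Fin n → ℕ) → ℕ
  ∏ {zero}  f = 1
  ∏ {suc n} f = f zero * ∏ (f ∘ suc)

  ∏≤1 : ∀ {n} {f : Fin n → ℕ} → (∀ i → f i ≤ 1) → ∏ f ≤ 1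
  ∏≤1 {zero}  f≤1 = ≤-refl
  ∏≤1 {suc n} f≤1 = *-mono-≤ (f≤1 zero) (∏≤1 (f≤1 ∘ suc))

  ∏≢0 : ∀ {n} {f : Fin n → ℕ} → ∏ f ≢ 0 → ∀ i → f i ≢ 0
  ∏≢0 {suc n} {f} ∏f≢0 zero f0≡0 = ∏f≢0 (cong (_* ∏ (f ∘ suc)) f0≡0)
  ∏≢0 {suc n} {f} ∏f≢0 (suc i) fi≡0 = ∏≢0 (λ ∏≡0 → ∏f≢0 (trans (cong (f zero *_) ∏≡0) (*-zeroʳ (f zero)))) i fi≡0

  -- The points of the edge are chosen one by one among the values of R, each keeping at least the
  -- average share of the weight carried by the sets (with indicators v p) that contain it.
  greedy-edge : ∀ s {n t D} κ c (v : Fin D → Fin t → ℕ) → (∀ p x → v p x ≤ 1) →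
    (R : Fin n → Fin t) → Injective _≡_ _≡_ R → s + suc κ * c ≤ n →
    (d : Fin D → ℕ) → (∀ p → n * d p ≤ d p * (c + sum (v p ∘ R))) →
    ∃ λ (S : Fin s → Fin t) → Injective _≡_ _≡_ S × (∀ a → ∃ λ b → S a ≡ R b) ×
      κ ^ s * sum d ≤ suc κ ^ s * sum (λ p → d p * ∏ (v p ∘ S))
  greedy-edge zero κ c v v≤1 R R-inj room d large = (λ ()) , (λ {}) , (λ ()) ,
    *-monoʳ-≤ 1 (≤-reflexive (Sum.sum-cong-≗ λ p → sym (*-identityʳ (d p))))
  greedy-edge (suc s) {suc n} {t} {D} κ c v v≤1 R R-inj (s≤s room) d large
    with above-average (λ a → sum (λ p → d p * v p (R a)))
  ... | a , a-above with greedy-edge s κ c v v≤1 (removeAt R a) (punchIn-injective a _ _ ∘ R-inj) room (λ p → d p * v p (R a)) large′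
    where
    -- The hypothesis says that a set of nonzero weight misses at most `c` of the remaining points.
    -- It survives the removal of `R a`: a set avoiding `R a` loses its weight, any other set misses
    -- the same points as before.
    large′ : ∀ p → n * (d p * v p (R a)) ≤ d p * v p (R a) * (c + sum (v p ∘ removeAt R a))
    large′ p = +-cancelˡ-≤ (d p * x) _ _ (begin
      d p * x + n * (d p * x)      ≡⟨ lemma (d p) x n ⟩
      suc n * d p * x              ≤⟨ *-monoˡ-≤ x (large p) ⟩
      d p * (c + sum (v p ∘ R)) * x ≡⟨ cong (λ e → d p * (c + e) * x) (Sum.sum-remove {i = a} (v p ∘ R)) ⟩
      d p * (c + (x + y)) * x      ≤⟨ *-monoˡ-≤ x (*-monoʳ-≤ (d p) (+-monoʳ-≤ c (+-monoˡ-≤ y (v≤1 p (R a))))) ⟩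
      d p * (c + (1 + y)) * x      ≡⟨ lemma′ (d p) c x y ⟩
      d p * x + d p * x * (c + y)  ∎)
      where
      open ≤-Reasoning
      x = v p (R a)
      y = sum (v p ∘ removeAt R a)
      lemma : ∀ d x n → d * x + n * (d * x) ≡ suc n * d * x
      lemma = solve-∀
      lemma′ : ∀ d c x y → d * (c + (1 + y)) * x ≡ d * x + d * x * (c + y)
      lemma′ = solve-∀
  ... | S , S-inj , S⊆R , heavy = R a ∷ᶠ S , injective , (λ { zero → a , refl ; (suc i) → map-punch (S⊆R i) }) , heavy′
    where
    open ≤-Reasoning
    map-punch : ∀ {y} → (∃ λ b → y ≡ removeAt R a b) → ∃ λ b → y ≡ R b
    map-punch (b , eq) = punchIn a b , eq
    fresh : ∀ i → S i ≢ R a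
    fresh i Si≡ with S⊆R i
    ... | b , eq = punchInᵢ≢i a b (R-inj (trans (sym eq) Si≡))
    injective : Injective _≡_ _≡_ (R a ∷ᶠ S)
    injective {zero} {zero} _ = refl
    injective {zero} {suc j} eq = contradiction (sym eq) (fresh j)
    injective {suc i} {zero} eq = contradiction eq (fresh i)
    injective {suc i} {suc j} eq = cong suc (S-inj eq)
    d′ : Fin D → ℕ
    d′ p = d p * v p (R a)
    average : suc n * sum d ≤ c * sum d + suc n * sum d′
    average = begin
      suc n * sum d                                   ≡⟨ Sum.*-distribˡ-sum (suc n) d ⟩
      sum (λ p → suc n * d p)                         ≤⟨ sum-mono large ⟩
      sum (λ p → d p * (c + sum (v p ∘ R)))
        ≡⟨ Sum.sum-cong-≗ (λ p → trans (*-distribˡ-+ (d p) c _) (cong₂ _+_ (*-comm (d p) c) (Sum.*-distribˡ-sum (d p) (v p ∘ R)))) ⟩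
      sum (λ p → c * d p + sum (λ b → d p * v p (R b)))
        ≡⟨ Sum.∑-distrib-+ (λ p → c * d p) (λ p → sum (λ b → d p * v p (R b))) ⟩
      sum (λ p → c * d p) + sum (λ p → sum (λ b → d p * v p (R b)))
        ≡⟨ cong₂ _+_ (sym (Sum.*-distribˡ-sum c d)) (Sum.∑-comm (λ p b → d p * v p (R b))) ⟩
      c * sum d + sum (λ b → sum (λ p → d p * v p (R b))) ≤⟨ +-monoʳ-≤ (c * sum d) a-above ⟩
      c * sum d + suc n * sum d′                      ∎
    -- By `room`, the `c` points that a weighted set may miss are at most a fraction 1/(κ + 1) of
    -- those remaining, so a point of at least average weight keeps a fraction κ/(κ + 1).
    share : κ * sum d ≤ suc κ * sum d′
    share = +-cancelˡ-≤ (sum d) _ _ (*-cancelˡ-≤ (suc n) (begin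
      suc n * (suc κ * sum d)                      ≡⟨ swap (suc n) (suc κ) (sum d) ⟩
      suc κ * (suc n * sum d)                      ≤⟨ *-monoʳ-≤ (suc κ) average ⟩
      suc κ * (c * sum d + suc n * sum d′)         ≡⟨ lemma κ c n (sum d) (sum d′) ⟩
      (suc κ * c) * sum d + suc n * (suc κ * sum d′)
        ≤⟨ +-monoˡ-≤ _ (*-monoˡ-≤ (sum d) (≤-trans (m≤n+m (suc κ * c) s) (m≤n⇒m≤1+n room))) ⟩
      suc n * sum d + suc n * (suc κ * sum d′)     ≡⟨ *-distribˡ-+ (suc n) (sum d) _ ⟨
      suc n * (sum d + suc κ * sum d′)             ∎))
      where
      swap : ∀ a b c → a * (b * c) ≡ b * (a * c)
      swap = solve-∀
      lemma : ∀ κ c n x y → suc κ * (c * x + suc n * y) ≡ (suc κ * c) * x + suc n * (suc κ * y)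
      lemma = solve-∀
    heavy′ : κ ^ suc s * sum d ≤ suc κ ^ suc s * sum (λ p → d p * (v p (R a) * ∏ (v p ∘ S)))
    heavy′ = begin
      κ * κ ^ s * sum d                ≡⟨ lemma κ (κ ^ s) (sum d) ⟩
      κ ^ s * (κ * sum d)              ≤⟨ *-monoʳ-≤ (κ ^ s) share ⟩
      κ ^ s * (suc κ * sum d′)         ≡⟨ lemma (suc κ) (κ ^ s) (sum d′) ⟨
      suc κ * κ ^ s * sum d′           ≡⟨ *-assoc (suc κ) (κ ^ s) (sum d′) ⟩
      suc κ * (κ ^ s * sum d′)         ≤⟨ *-monoʳ-≤ (suc κ) heavy ⟩
      suc κ * (suc κ ^ s * sum (λ p → d′ p * ∏ (v p ∘ S))) ≡⟨ *-assoc (suc κ) (suc κ ^ s) _ ⟨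
      suc κ ^ suc s * sum (λ p → d′ p * ∏ (v p ∘ S))
        ≡⟨ cong (suc κ ^ suc s *_) (Sum.sum-cong-≗ λ p → *-assoc (d p) (v p (R a)) _) ⟩
      suc κ ^ suc s * sum (λ p → d p * (v p (R a) * ∏ (v p ∘ S))) ∎
      where
      lemma : ∀ a b c → a * b * c ≡ b * (a * c)
      lemma = solve-∀

  module _ {t D : ℕ} (s κ c μ : ℕ) (v : Fin D → Fin t → ℕ) (v≤1 : ∀ p x → v p x ≤ 1)
           (room : s + suc κ * c ≤ t) (μ-large : suc κ ^ s ≤ suc μ * κ ^ s) where

    -- A set loses its weight as soon as it contains an edge. By `μ-large` each greedy edge captures
    -- at least a fraction 1/(μ + 1) of the weight still present, so the surviving fraction decays
    -- like (μ/(μ + 1))^m.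
    greedy-edges : ∀ m (d : Fin D → ℕ) → (∀ p → t * d p ≤ d p * (c + sum (v p))) →
      ∃ λ (S : Fin m → Fin s → Fin t) → (∀ j → Injective _≡_ _≡_ (S j)) ×
      ∃ λ (d′ : Fin D → ℕ) → suc μ ^ m * sum d′ ≤ μ ^ m * sum d ×
        (∀ p → d p ≡ d′ p ⊎ ∃ λ j → ∏ (v p ∘ S j) ≢ 0)
    greedy-edges zero d large = (λ ()) , (λ ()) , d , ≤-refl , λ p → inj₁ refl
    greedy-edges (suc m) d large with greedy-edge s κ c v v≤1 id id room d large
    ... | S₀ , S₀-inj , _ , heavy with greedy-edges m (λ p → d p * (1 ∸ ∏ (v p ∘ S₀))) large₁
      where
      large₁ : ∀ p → t * (d p * (1 ∸ ∏ (v p ∘ S₀))) ≤ d p * (1 ∸ ∏ (v p ∘ S₀)) * (c + sum (v p))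
      large₁ p = subst₂ _≤_ (*-assoc t (d p) x) (lemma (d p) x (c + sum (v p))) (*-monoˡ-≤ x (large p))
        where
        x = 1 ∸ ∏ (v p ∘ S₀)
        lemma : ∀ a b c → a * c * b ≡ a * b * c
        lemma = solve-∀
    ... | S , S-inj , d′ , light , alive = S₀ ∷ᶠ S , (λ { zero → S₀-inj ; (suc j) → S-inj j }) , d′ , light′ , alive′
      where
      open ≤-Reasoning
      d₁ d₂ : Fin D → ℕ
      d₁ p = d p * (1 ∸ ∏ (v p ∘ S₀))
      d₂ p = d p * ∏ (v p ∘ S₀)
      split : sum d ≡ sum d₁ + sum d₂
      split = trans (Sum.sum-cong-≗ λ p → trans (sym (*-identityʳ (d p))) (trans (cong (d p *_) (sym (m∸n+n≡m (∏≤1 (v≤1 p ∘ S₀))))) (*-distribˡ-+ (d p) _ _)))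
                    (Sum.∑-distrib-+ d₁ d₂)
      κ^s-nonZero : NonZero (κ ^ s)
      κ^s-nonZero = ≢-nonZero λ κ^s≡0 → <⇒≱ (m^n>0 (suc κ) s) (subst (suc κ ^ s ≤_) (trans (cong (suc μ *_) κ^s≡0) (*-zeroʳ (suc μ))) μ-large)
      contained : sum d ≤ suc μ * sum d₂
      contained = *-cancelˡ-≤ (κ ^ s) {{κ^s-nonZero}} (begin
        κ ^ s * sum d              ≤⟨ heavy ⟩
        suc κ ^ s * sum d₂         ≤⟨ *-monoˡ-≤ (sum d₂) μ-large ⟩
        suc μ * κ ^ s * sum d₂     ≡⟨ lemma (suc μ) (κ ^ s) (sum d₂) ⟩
        κ ^ s * (suc μ * sum d₂)   ∎)
        where
        lemma : ∀ a b c → a * b * c ≡ b * (a * c)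
        lemma = solve-∀
      missed : suc μ * sum d₁ ≤ μ * sum d
      missed = +-cancelʳ-≤ (sum d) _ _ (begin
        suc μ * sum d₁ + sum d            ≤⟨ +-monoʳ-≤ (suc μ * sum d₁) contained ⟩
        suc μ * sum d₁ + suc μ * sum d₂   ≡⟨ *-distribˡ-+ (suc μ) (sum d₁) (sum d₂) ⟨
        suc μ * (sum d₁ + sum d₂)         ≡⟨ cong (suc μ *_) split ⟨
        suc μ * sum d                     ≡⟨ +-comm (sum d) (μ * sum d) ⟩
        μ * sum d + sum d                 ∎)
      light′ : suc μ ^ suc m * sum d′ ≤ μ ^ suc m * sum d
      light′ = begin
        suc μ * suc μ ^ m * sum d′     ≡⟨ *-assoc (suc μ) (suc μ ^ m) (sum d′) ⟩
        suc μ * (suc μ ^ m * sum d′)   ≤⟨ *-monoʳ-≤ (suc μ) light ⟩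
        suc μ * (μ ^ m * sum d₁)       ≡⟨ lemma (suc μ) (μ ^ m) (sum d₁) ⟩
        μ ^ m * (suc μ * sum d₁)       ≤⟨ *-monoʳ-≤ (μ ^ m) missed ⟩
        μ ^ m * (μ * sum d)            ≡⟨ lemma′ (μ ^ m) μ (sum d) ⟩
        μ * μ ^ m * sum d              ∎
        where
        lemma : ∀ a b c → a * (b * c) ≡ b * (a * c)
        lemma = solve-∀
        lemma′ : ∀ a b c → a * (b * c) ≡ b * a * c
        lemma′ = solve-∀
      alive′ : ∀ p → d p ≡ d′ p ⊎ ∃ λ j → ∏ (v p ∘ (S₀ ∷ᶠ S) j) ≢ 0
      alive′ p with ∏ (v p ∘ S₀) ≟ 0 | alive p
      ... | no ≢0 | _ = inj₂ (zero , ≢0)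
      ... | yes _ | inj₂ (j , ≢0) = inj₂ (suc j , ≢0)
      ... | yes ≡0 | inj₁ d₁≡d′ = inj₁ (trans (trans (sym (*-identityʳ (d p))) (cong (λ e → d p * (1 ∸ e)) (sym ≡0))) d₁≡d′)

  -- B ranges over complements of potential hitting sets, so no set of at most c points meets all edges.
  hypergraph : ∀ {m t} s κ c μ → s + suc κ * c ≤ t → suc κ ^ s ≤ suc μ * κ ^ s → μ ^ m * 2 ^ t < suc μ ^ m →
    ∃ λ (S : Fin m → Fin s → Fin t) → (∀ j → Injective _≡_ _≡_ (S j)) ×
      (∀ (B : Fin t → Fin 2) → t ≤ c + sum (toℕ ∘ B) → ∃ λ j → ∀ a → B (S j a) ≢ zero)
  hypergraph {m} {t} s κ c μ room μ-large m-large = S , S-inj , contains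
    where
    open ≤-Reasoning
    -- Subsets of the points are coded by numbers below 2^t; those missing more than `c` points get
    -- initial weight 0.
    v : Fin (2 ^ t) → Fin t → ℕ
    v p x = toℕ (finToFun p x)
    d : Fin (2 ^ t) → ℕ
    d p = if does (t ≤? c + sum (v p)) then 1 else 0
    d≤1 : ∀ p → d p ≤ 1
    d≤1 p with does (t ≤? c + sum (v p))
    ... | true = ≤-refl
    ... | false = z≤n
    large : ∀ p → t * d p ≤ d p * (c + sum (v p))
    large p = weigh (t ≤? c + sum (v p))
      where
      weigh : ∀ {e} (t≤? : Dec (t ≤ e)) → t * (if does t≤? then 1 else 0) ≤ (if does t≤? then 1 else 0) * e
      weigh (yes t≤) = subst₂ _≤_ (sym (*-identityʳ t)) (sym (*-identityˡ _)) t≤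
      weigh (no _) = ≤-reflexive (*-zeroʳ t)
    edges = greedy-edges s κ c μ v (λ p x → toℕ≤pred[n] (finToFun p x)) room μ-large m d large
    S = proj₁ edges
    S-inj = proj₁ (proj₂ edges)
    d′ = proj₁ (proj₂ (proj₂ edges))
    d′-light : suc μ ^ m * sum d′ ≤ μ ^ m * sum d
    d′-light = proj₁ (proj₂ (proj₂ (proj₂ edges)))
    -- The initial weight is at most 2^t, so by `m-large` the surviving weight is an integer below
    -- 1.
    sum-d′ : sum d′ ≡ 0
    sum-d′ = n<1⇒n≡0 (*-cancelˡ-< (suc μ ^ m) _ _ (begin-strict
      suc μ ^ m * sum d′             ≤⟨ d′-light ⟩
      μ ^ m * sum d                  ≤⟨ *-monoʳ-≤ (μ ^ m) (sum-mono d≤1) ⟩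
      μ ^ m * sum {2 ^ t} (λ _ → 1)  ≡⟨ cong (μ ^ m *_) (trans (sum-const (2 ^ t) 1) (*-identityʳ _)) ⟩
      μ ^ m * 2 ^ t                  <⟨ m-large ⟩
      suc μ ^ m                      ≡⟨ *-identityʳ _ ⟨
      suc μ ^ m * 1                  ∎))
    contains : ∀ (B : Fin t → Fin 2) → t ≤ c + sum (toℕ ∘ B) → ∃ λ j → ∀ a → B (S j a) ≢ zero
    contains B t≤ with proj₂ (proj₂ (proj₂ (proj₂ edges))) (funToFin B)
    ... | inj₂ (j , ∏≢) = j , λ a Ba≡0 → ∏≢0 ∏≢ a (cong toℕ (trans (finToFun-funToFin B (S j a)) Ba≡0))
    ... | inj₁ d≡d′ = contradiction (trans (sym d≡1) (trans d≡d′ (n≤0⇒n≡0 (subst (d′ (funToFin B) ≤_) sum-d′ (≤sum d′ (funToFin B)))))) λ ()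
      where
      d≡1 : d (funToFin B) ≡ 1
      d≡1 = cong (if_then 1 else 0) (dec-true (t ≤? c + sum (v (funToFin B)))
        (subst (λ e → t ≤ c + e) (Sum.sum-cong-≗ λ x → cong toℕ (sym (finToFun-funToFin B x))) t≤))

  sum-exclusive : ∀ {n} {P : Fin n → Set} (P? : ∀ i → Dec (P i)) → (∀ {i j} → P i → P j → i ≡ j) →
                  sum (λ i → if does (P? i) then 1 else 0) ≤ 1
  sum-exclusive {zero} P? exclusive = z≤n
  sum-exclusive {suc n} P? exclusive with P? zero
  ... | yes P0 = s≤s (≤-reflexive (trans (Sum.sum-cong-≗ λ i → cong (if_then 1 else 0) (dec-false (P? (suc i)) λ Pi → contradiction (exclusive P0 Pi) λ ()))
                                          (trans (sum-const n 0) (*-zeroʳ n))))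
  ... | no _ = sum-exclusive (P? ∘ suc) λ Pi Pj → Fin.suc-injective (exclusive Pi Pj)

  -- All parts carry the same lists: the edges of a hypergraph with every point replaced by r copies.
  -- The colours used on a part then project to a hitting set, so each part uses more than c colours.
  hypergraph⇒¬choosable : ∀ {m t s c r k} (S : Fin m → Fin s → Fin t) → (∀ j → Injective _≡_ _≡_ (S j)) →
    (∀ (B : Fin t → Fin 2) → t ≤ c + sum (toℕ ∘ B) → ∃ λ j → ∀ a → B (S j a) ≢ zero) →
    t * r < k * suc c → ¬ Choosable (KAdj m k) (s * r)
  hypergraph⇒¬choosable {m} {t} {s} {c} {r} {k} S S-inj contains overfull choosable = <⇒≱ overfull (begin
    k * suc c                                              ≡⟨ sum-const k (suc c) ⟨
    sum {k} (λ _ → suc c)                                  ≤⟨ sum-mono many ⟩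
    sum (λ i → sum (λ x → sum (λ l → U i x l)))            ≡⟨ Sum.∑-comm (λ i x → sum (λ l → U i x l)) ⟩
    sum (λ x → sum (λ i → sum (λ l → U i x l)))            ≡⟨ Sum.sum-cong-≗ (λ x → Sum.∑-comm (λ i l → U i x l)) ⟩
    sum (λ x → sum (λ l → sum (λ i → U i x l)))            ≤⟨ sum-mono (λ x → sum-mono (λ l → sum-exclusive (λ i → used? i x l) exclusive)) ⟩
    sum {t} (λ x → sum {r} (λ l → 1))                      ≡⟨ trans (Sum.sum-cong-≗ {t} (λ x → trans (sum-const r 1) (*-identityʳ r))) (sum-const t r) ⟩
    t * r                                                  ∎)
    where
    open ≤-Reasoning
    encode : Fin t → Fin r → ℕ
    encode x l = toℕ (combine x l)
    entry : Fin m → Fin (s * r) → ℕ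
    entry j p = encode (S j (proj₁ (remQuot {s} r p))) (proj₂ (remQuot {s} r p))
    entry-injective : ∀ j {p q} → entry j p ≡ entry j q → p ≡ q
    entry-injective j {p} {q} eq with combine-injective _ _ _ _ (toℕ-injective eq)
    ... | S≡ , l≡ = trans (sym (combine-remQuot {s} r p)) (trans (cong₂ combine (S-inj j S≡) l≡) (combine-remQuot {s} r q))
    coloured = choosable (λ (i , j) → List.tabulate (entry j)) (λ (i , j) → length-tabulate (entry j) , Unique.tabulate⁺ (entry-injective j))
    f = proj₁ coloured
    Used : Fin k → Fin t → Fin r → Set
    Used i x l = ∃ λ j → f (i , j) ≡ encode x l
    used? : ∀ i x l → Dec (Used i x l)
    used? i x l = any? λ j → f (i , j) ≟ encode x l
    U : Fin k → Fin t → Fin r → ℕ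
    U i x l = if does (used? i x l) then 1 else 0
    exclusive : ∀ {x l i i′} → Used i x l → Used i′ x l → i ≡ i′
    exclusive {i = i} {i′} (j , eq) (j′ , eq′) = decidable-stable (i Fin.≟ i′) λ i≢i′ → proj₂ (proj₂ coloured) _ _ i≢i′ (trans eq (sym eq′))
    B : Fin k → Fin t → Fin 2
    B i x = if does (any? (used? i x)) then zero else suc zero
    -- `B i` is the complement of the projected colours of part `i`. An edge `j` inside it would
    -- contradict that the vertex (i, j) takes its colour from its own list.
    unhit : ∀ i → ¬ t ≤ c + sum (toℕ ∘ B i)
    unhit i t≤ with contains (B i) t≤
    ... | j , avoids with ∈-tabulate⁻ {f = entry j} (proj₁ (proj₂ coloured) (i , j))
    ... | p , eq = avoids (proj₁ (remQuot {s} r p)) (cong (if_then zero else suc zero) (dec-true (any? (used? i _)) (proj₂ (remQuot {s} r p) , j , eq)))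
    cover : ∀ i x → 1 ≤ toℕ (B i x) + sum (λ l → U i x l)
    cover i x with any? (used? i x)
    ... | no _ = s≤s z≤n
    ... | yes (l , used) = ≤-trans (≤-reflexive (sym (cong (if_then 1 else 0) (dec-true (used? i x l) used)))) (≤sum (U i x) l)
    many : ∀ i → suc c ≤ sum (λ x → sum (λ l → U i x l))
    many i = +-cancelʳ-≤ (sum (toℕ ∘ B i)) _ _ (begin
      suc c + sum (toℕ ∘ B i)                                    ≤⟨ ≰⇒> (unhit i) ⟩
      t                                                          ≡⟨ trans (sum-const t 1) (*-identityʳ t) ⟨
      sum {t} (λ _ → 1)                                          ≤⟨ sum-mono (cover i) ⟩
      sum (λ x → toℕ (B i x) + sum (λ l → U i x l))              ≡⟨ Sum.∑-distrib-+ (toℕ ∘ B i) (λ x → sum (λ l → U i x l)) ⟩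
      sum (toℕ ∘ B i) + sum (λ x → sum (λ l → U i x l))          ≡⟨ +-comm (sum (toℕ ∘ B i)) _ ⟩
      sum (λ x → sum (λ l → U i x l)) + sum (toℕ ∘ B i)          ∎)

  -- Lower bound: choice of parameters

  m<[1+m/n]*n : ∀ m n .{{_ : NonZero n}} → m < suc (m / n) * n
  m<[1+m/n]*n m n = subst (_< suc (m / n) * n) (sym (m≡m%n+[m/n]*n m n)) (+-monoˡ-< (m / n * n) (m%n<n m n))

  -- With t = (κ + 2) s points and c = s, the first hypothesis reads m ≥ 2 (t + 1) ((κ + 1)/κ)^s.
  -- Since μ + 1 ≤ 2 ((κ + 1)/κ)^s, it yields (μ + 1)(t + 1) edges, and (1 + 1/μ)^(μ + 1) ≥ 2 then
  -- beats the 2^t candidate sets. The second hypothesis leaves at most k s colours for k parts that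
  -- need s + 1 each.
  ¬choosable : ∀ {m k} s r κ → .{{NonZero κ}} → .{{NonZero k}} →
    suc κ ^ s * (2 * suc (suc (suc κ) * s)) ≤ m * κ ^ s → suc (suc κ) * r ≤ k → ¬ Choosable (KAdj m k) (s * r)
  ¬choosable {m} {k} s r κ m-large r-small =
    hypergraph⇒¬choosable {r = r} S S-inj contains (begin-strict
      t * r                      ≡⟨ regroup s κ r ⟩
      suc (suc κ) * r * s        ≤⟨ *-monoˡ-≤ s r-small ⟩
      k * s                      <⟨ *-monoʳ-< k (n<1+n s) ⟩
      k * suc s                  ∎)
    where
    open ≤-Reasoning
    instance
      κ^s≢0 : NonZero (κ ^ s)
      κ^s≢0 = m^n≢0 κ s
    t = s + suc κ * s
    regroup : ∀ s κ r → (s + suc κ * s) * r ≡ suc (suc κ) * r * s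
    regroup = solve-∀
    μ = suc κ ^ s / κ ^ s
    μ-large : suc κ ^ s ≤ suc μ * κ ^ s
    μ-large = <⇒≤ (m<[1+m/n]*n (suc κ ^ s) (κ ^ s))
    μ-small : suc μ * κ ^ s ≤ 2 * suc κ ^ s
    μ-small = begin
      κ ^ s + μ * κ ^ s            ≤⟨ +-mono-≤ (^-monoˡ-≤ s (n≤1+n κ)) (m/n*n≤m (suc κ ^ s) (κ ^ s)) ⟩
      suc κ ^ s + suc κ ^ s        ≡⟨ cong (suc κ ^ s +_) (+-identityʳ (suc κ ^ s)) ⟨
      2 * suc κ ^ s                ∎
    instance
      μ≢0 : NonZero μ
      μ≢0 = ≢-nonZero λ μ≡0 → <⇒≱ (m<[1+m/n]*n (suc κ ^ s) (κ ^ s))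
        (subst (λ e → suc e * κ ^ s ≤ suc κ ^ s) (sym μ≡0) (subst (_≤ suc κ ^ s) (sym (+-identityʳ (κ ^ s))) (^-monoˡ-≤ s (n≤1+n κ))))
    enough-edges : suc μ * suc t ≤ m
    enough-edges = *-cancelʳ-≤ _ _ (κ ^ s) (begin
      suc μ * suc t * κ ^ s          ≡⟨ lemma (suc μ) (suc t) (κ ^ s) ⟩
      suc μ * κ ^ s * suc t          ≤⟨ *-monoˡ-≤ (suc t) μ-small ⟩
      2 * suc κ ^ s * suc t          ≡⟨ lemma′ s κ (suc κ ^ s) ⟩
      suc κ ^ s * (2 * suc (suc (suc κ) * s)) ≤⟨ m-large ⟩
      m * κ ^ s                      ∎)
      where
      lemma : ∀ a b c → a * b * c ≡ a * c * b
      lemma = solve-∀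
      lemma′ : ∀ s κ e → 2 * e * suc (s + suc κ * s) ≡ e * (2 * suc (suc (suc κ) * s))
      lemma′ = solve-∀
    few-survivors : μ ^ m * 2 ^ t < suc μ ^ m
    few-survivors with m≤n⇒∃[o]m+o≡n enough-edges
    ... | z , refl = begin-strict
      μ ^ (suc μ * suc t + z) * 2 ^ t                  ≡⟨ cong (_* 2 ^ t) (^-distribˡ-+-* μ (suc μ * suc t) z) ⟩
      μ ^ (suc μ * suc t) * μ ^ z * 2 ^ t              <⟨ *-monoʳ-< (μ ^ (suc μ * suc t) * μ ^ z) {{m*n≢0 _ _ {{m^n≢0 μ (suc μ * suc t)}} {{m^n≢0 μ z}}}} (^-monoʳ-< 2 (s≤s (s≤s z≤n)) (n<1+n t)) ⟩
      μ ^ (suc μ * suc t) * μ ^ z * 2 ^ suc t          ≡⟨ lemma (μ ^ (suc μ * suc t)) (μ ^ z) (2 ^ suc t) ⟩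
      2 ^ suc t * μ ^ (suc μ * suc t) * μ ^ z          ≤⟨ *-mono-≤ (double-pow-iterate μ (suc μ) (suc t) (n≤1+n μ)) (^-monoˡ-≤ z (n≤1+n μ)) ⟩
      suc μ ^ (suc μ * suc t) * suc μ ^ z              ≡⟨ ^-distribˡ-+-* (suc μ) (suc μ * suc t) z ⟨
      suc μ ^ (suc μ * suc t + z)                      ∎
      where
      lemma : ∀ a b c → a * b * c ≡ c * a * b
      lemma = solve-∀
    edges = hypergraph {m} {t} s κ s μ ≤-refl μ-large few-survivors
    S = proj₁ edges
    S-inj = proj₁ (proj₂ edges)
    contains = proj₂ (proj₂ edges)

  -- Serves to absorb a factor `E` linear in the list size. One use of Bernoulli gives only a factor
  -- linear in `w`, possibly with too small a constant; its square wins for large `w`.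
  quadratic-growth : ∀ κ w E → .{{NonZero κ}} → κ * κ * E ≤ (κ + w) * (κ + w) → E * κ ^ (2 * w) ≤ suc κ ^ (2 * w)
  quadratic-growth κ w E E≤ = *-cancelˡ-≤ (κ * κ) {{m*n≢0 κ κ}} (begin
    κ * κ * (E * κ ^ (2 * w))                    ≡⟨ cong (λ e → κ * κ * (E * e)) (^2* κ) ⟩
    κ * κ * (E * (κ ^ w * κ ^ w))                ≡⟨ *-assoc (κ * κ) E _ ⟨
    κ * κ * E * (κ ^ w * κ ^ w)                  ≤⟨ *-monoˡ-≤ (κ ^ w * κ ^ w) E≤ ⟩
    (κ + w) * (κ + w) * (κ ^ w * κ ^ w)          ≡⟨ lemma (κ + w) (κ ^ w) ⟩
    κ ^ w * (κ + w) * (κ ^ w * (κ + w))          ≤⟨ *-mono-≤ (bernoulli κ w) (bernoulli κ w) ⟩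
    suc κ ^ w * κ * (suc κ ^ w * κ)              ≡⟨ lemma κ (suc κ ^ w) ⟨
    κ * κ * (suc κ ^ w * suc κ ^ w)              ≡⟨ cong (κ * κ *_) (^2* (suc κ)) ⟨
    κ * κ * suc κ ^ (2 * w)                      ∎)
    where
    open ≤-Reasoning
    ^2* : ∀ a → a ^ (2 * w) ≡ a ^ w * a ^ w
    ^2* a = trans (cong (a ^_) (cong (w +_) (+-identityʳ w))) (^-distribˡ-+-* a w w)
    lemma : ∀ a b → a * a * (b * b) ≡ b * a * (b * a)
    lemma = solve-∀

  -- n / κ is an upper estimate of ln m, so the bound is (1 - 1/d) k ln m ≤ s.
  choice-number-lower : ∀ d′ → let d = suc d′; κ = 8 * d in
    ∃ λ N → ∀ m k → N ≤ m → N ≤ k → ∀ s → Choosable (KAdj m k) s →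
      ∃ λ n → m * κ ^ n ≤ suc κ ^ n × n * d′ * k ≤ s * d * κ
  choice-number-lower d′ = N , bound
    where
    open ≤-Reasoning
    d = suc d′
    κ = 8 * d
    E : ℕ → ℕ
    E s = 2 * suc (suc (suc κ) * s)
    -- `E` is affine, so E ((w + 1) 16 d) ≤ C (w + 1) ≤ 2 C w, and for w ≥ W the square of `w`
    -- outweighs κ^2 times this. From `s₀` on, s/(16 d) is at least `W`. The summands of `N` make
    -- `m` large enough for `s₀` and `k` large enough for r ≥ 4 d.
    C = E (16 * d)
    W = 2 * (κ * κ * C)
    s₀ = 16 * d * W
    N = suc κ ^ s₀ * E s₀ + 4 * d * suc (suc κ)
    bound : ∀ m k → N ≤ m → N ≤ k → ∀ s → Choosable (KAdj m k) s →
      ∃ λ n → m * κ ^ n ≤ suc κ ^ n × n * d′ * k ≤ s * d * κ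
    bound m k N≤m N≤k s̃ choosable = n , growth , ratio
      where
      -- The negated size hypothesis of `¬choosable`. At the crossing it holds for `s` and fails for
      -- `suc s`, which bounds `m` from both sides by powers of 1 + 1/κ.
      Fails : ℕ → Set
      Fails i = m * κ ^ (s₀ + i) < suc κ ^ (s₀ + i) * E (s₀ + i)
      ¬Fails0 : ¬ Fails 0
      ¬Fails0 fails = <⇒≱ fails (begin
        suc κ ^ (s₀ + 0) * E (s₀ + 0)    ≡⟨ cong (λ e → suc κ ^ e * E e) (+-identityʳ s₀) ⟩
        suc κ ^ s₀ * E s₀                ≤⟨ m≤m+n _ _ ⟩
        N                                ≤⟨ N≤m ⟩
        m                                ≡⟨ *-identityʳ m ⟨
        m * 1                            ≤⟨ *-monoʳ-≤ m (m^n>0 κ (s₀ + 0)) ⟩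
        m * κ ^ (s₀ + 0)                 ∎)
      Fails-m : Fails m
      Fails-m = begin-strict
        m * κ ^ (s₀ + m)                 ≡⟨ *-comm m _ ⟩
        κ ^ (s₀ + m) * m                 <⟨ *-monoʳ-< (κ ^ (s₀ + m)) {{m^n≢0 κ (s₀ + m)}} (n<1+n m) ⟩
        κ ^ (s₀ + m) * suc m             ≤⟨ *-mono-≤ (^-monoˡ-≤ (s₀ + m) (n≤1+n κ)) (≤-trans (s≤s (≤-trans (m≤n+m m s₀) (m≤m+n _ _))) (m≤m+n _ _)) ⟩
        suc κ ^ (s₀ + m) * E (s₀ + m)    ∎
      last = threshold (λ i → m * κ ^ (s₀ + i) <? suc κ ^ (s₀ + i) * E (s₀ + i)) ¬Fails0 Fails-m
      s = s₀ + proj₁ last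
      r = k / suc (suc κ)
      w = s / (16 * d)
      -- The 2 w extra steps pay for the factor `E (suc s)`; as w ≤ s/(16 d), they add at most s/(8
      -- d).
      n = suc s + 2 * w
      instance
        k≢0 : NonZero k
        k≢0 = >-nonZero (≤-trans (≤-trans (s≤s z≤n) (m≤n+m _ (suc κ ^ s₀ * E s₀))) N≤k)
      sr≤s̃ : s * r ≤ s̃
      sr≤s̃ = ≮⇒≥ λ s̃<sr → ¬choosable s r κ (≮⇒≥ (proj₁ (proj₂ last)))
        (subst (_≤ k) (*-comm r (suc (suc κ))) (m/n*n≤m k (suc (suc κ)))) (choosable-mono-lists (<⇒≤ s̃<sr) choosable)
      s< : suc s ≤ suc w * (16 * d)
      s< = m<[1+m/n]*n s (16 * d)
      W≤w : W ≤ w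
      W≤w = s≤s⁻¹ (*-cancelʳ-< (16 * d) W (suc w) (≤-<-trans (subst (_≤ s) (*-comm (16 * d) W) (m≤m+n s₀ _)) s<))
      1≤w : 1 ≤ w
      1≤w = ≤-trans (s≤s z≤n) W≤w
      E≤ : κ * κ * E (suc s) ≤ (κ + w) * (κ + w)
      E≤ = begin
        κ * κ * E (suc s)                      ≤⟨ *-monoʳ-≤ (κ * κ) (*-monoʳ-≤ 2 (s≤s (*-monoʳ-≤ (suc (suc κ)) s<))) ⟩
        κ * κ * E (suc w * (16 * d))           ≤⟨ *-monoʳ-≤ (κ * κ) (≤-trans (m≤m+n _ (2 * w)) (≤-reflexive (lemma (suc (suc κ)) w (16 * d)))) ⟩
        κ * κ * (C * suc w)                    ≤⟨ *-monoʳ-≤ (κ * κ) (*-monoʳ-≤ C (+-monoˡ-≤ w 1≤w)) ⟩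
        κ * κ * (C * (w + w))                  ≡⟨ lemma′ (κ * κ) C w ⟩
        W * w                                  ≤⟨ *-monoˡ-≤ w W≤w ⟩
        w * w                                  ≤⟨ *-mono-≤ (m≤n+m w κ) (m≤n+m w κ) ⟩
        (κ + w) * (κ + w)                      ∎
        where
        lemma : ∀ a w b → 2 * suc (a * (suc w * b)) + 2 * w ≡ 2 * suc (a * b) * suc w
        lemma = solve-∀
        lemma′ : ∀ a c w → a * (c * (w + w)) ≡ 2 * (a * c) * w
        lemma′ = solve-∀
      growth : m * κ ^ n ≤ suc κ ^ n
      growth = begin
        m * κ ^ (suc s + 2 * w)                        ≡⟨ cong (m *_) (^-distribˡ-+-* κ (suc s) (2 * w)) ⟩
        m * (κ ^ suc s * κ ^ (2 * w))                  ≡⟨ *-assoc m _ _ ⟨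
        m * κ ^ suc s * κ ^ (2 * w)                    ≤⟨ *-monoˡ-≤ _ (<⇒≤ (subst (λ e → m * κ ^ e < suc κ ^ e * E e) (+-suc s₀ _) (proj₂ (proj₂ last)))) ⟩
        suc κ ^ suc s * E (suc s) * κ ^ (2 * w)        ≡⟨ *-assoc (suc κ ^ suc s) _ _ ⟩
        suc κ ^ suc s * (E (suc s) * κ ^ (2 * w))      ≤⟨ *-monoʳ-≤ (suc κ ^ suc s) (quadratic-growth κ w (E (suc s)) E≤) ⟩
        suc κ ^ suc s * suc κ ^ (2 * w)                ≡⟨ ^-distribˡ-+-* (suc κ) (suc s) (2 * w) ⟨
        suc κ ^ n                                      ∎
      -- Three losses of a factor at most 1 + 1/e each are collected: `n` against `s`, `suc r`
      -- against `r`, and κ + 2 against κ = 8 d, an equality. They fit since (1 + 1/e)^3 (1 - 1/d) ≤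
      -- 1.
      e = 4 * d
      n-small : n * e ≤ s * suc e
      n-small = begin
        n * e                           ≡⟨ lemma s w d ⟩
        s * e + (4 * d * 1 + 8 * d * w) ≤⟨ +-monoʳ-≤ (s * e) (+-monoˡ-≤ (8 * d * w) (*-monoʳ-≤ (4 * d) 1≤w)) ⟩
        s * e + (4 * d * w + 8 * d * w) ≤⟨ +-monoʳ-≤ (s * e) (≤-trans (m≤m+n _ (4 * d * w)) (≤-reflexive (lemma′ d w))) ⟩
        s * e + w * (16 * d)            ≤⟨ +-monoʳ-≤ (s * e) (m/n*n≤m s (16 * d)) ⟩
        s * e + s                       ≡⟨ trans (+-comm (s * e) s) (sym (*-suc s e)) ⟩
        s * suc e                       ∎
        where
        lemma : ∀ s w d → (suc s + 2 * w) * (4 * d) ≡ s * (4 * d) + (4 * d * 1 + 8 * d * w)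
        lemma = solve-∀
        lemma′ : ∀ d w → 4 * d * w + 8 * d * w + 4 * d * w ≡ w * (16 * d)
        lemma′ = solve-∀
      k< : k ≤ suc r * suc (suc κ)
      k< = <⇒≤ (m<[1+m/n]*n k (suc (suc κ)))
      e≤r : e ≤ r
      e≤r = s≤s⁻¹ (*-cancelʳ-< (suc (suc κ)) e (suc r) (≤-<-trans (≤-trans (m≤n+m _ (suc κ ^ s₀ * E s₀)) N≤k) (m<[1+m/n]*n k (suc (suc κ)))))
      r-large : suc r * e ≤ r * suc e
      r-large = begin
        e + r * e    ≤⟨ +-monoˡ-≤ (r * e) e≤r ⟩
        r + r * e    ≡⟨ *-suc r e ⟨
        r * suc e    ∎
      ratio : n * d′ * k ≤ s̃ * d * κ
      ratio = *-cancelʳ-≤ _ _ (e * e * e) (begin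
        n * d′ * k * (e * e * e)                           ≤⟨ *-monoˡ-≤ (e * e * e) (*-monoʳ-≤ (n * d′) k<) ⟩
        n * d′ * (suc r * suc (suc κ)) * (e * e * e)       ≡⟨ lemma n d′ (suc r) (suc (suc κ)) e ⟩
        n * e * (suc r * e) * (suc (suc κ) * e) * d′       ≤⟨ *-monoˡ-≤ d′ (*-mono-≤ (*-mono-≤ n-small r-large) (≤-reflexive (lemma₁ d))) ⟩
        s * suc e * (r * suc e) * (κ * suc e) * d′         ≡⟨ lemma₂ s r κ (suc e) d′ ⟩
        s * r * κ * (suc e * suc e * suc e * d′)           ≤⟨ *-monoʳ-≤ (s * r * κ) (≤-trans (m≤m+n _ (16 * (d * d * d) + 36 * (d * d) + 11 * d + 1)) (≤-reflexive (lemma₃ d′))) ⟩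
        s * r * κ * (e * e * e * d)                        ≤⟨ *-monoˡ-≤ (e * e * e * d) (*-monoˡ-≤ κ sr≤s̃) ⟩
        s̃ * κ * (e * e * e * d)                            ≡⟨ lemma₄ s̃ κ (e * e * e) d ⟩
        s̃ * d * κ * (e * e * e)                            ∎)
        where
        lemma : ∀ n d′ r κ e → n * d′ * (r * κ) * (e * e * e) ≡ n * e * (r * e) * (κ * e) * d′
        lemma = solve-∀
        lemma₁ : ∀ d → suc (suc (8 * d)) * (4 * d) ≡ 8 * d * suc (4 * d)
        lemma₁ = solve-∀
        lemma₂ : ∀ s r κ e d′ → s * e * (r * e) * (κ * e) * d′ ≡ s * r * κ * (e * e * e * d′)
        lemma₂ = solve-∀
        lemma₃ : ∀ d′ → let d = suc d′; e = 4 * d in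
          suc e * suc e * suc e * d′ + (16 * (d * d * d) + 36 * (d * d) + 11 * d + 1) ≡ e * e * e * d
        lemma₃ = solve-∀
        lemma₄ : ∀ s κ f d → s * κ * (f * d) ≡ s * d * κ * f
        lemma₄ = solve-∀

  -- Upper bound: repeated halving

  choosable-one-part : ∀ {m} → Choosable (KAdj m 1) 1
  choosable-one-part {m} L assign = (λ v → proj₁ (first v)) , (λ v → proj₂ (first v)) ,
    λ { (zero , _) (zero , _) 0≢0 _ → 0≢0 refl }
    where
    nonempty : ∀ (l : List ℕ) → length l ≡ 1 → ∃ (_∈ l)
    nonempty (x ∷ l) _ = x , here refl
    first : ∀ v → ∃ (_∈ L v)
    first v = nonempty (L v) (proj₁ (assign v))

  -- With weights 0 and 1 the Chernoff argument degenerates to the first moment method: only lists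
  -- that miss their own class entirely have nonzero weight.
  choosable-first-moment : ∀ {m} κ s → suc κ * m * κ ^ s < suc κ ^ s → Choosable (KAdj m (suc κ)) s
  choosable-first-moment {m} κ s small = subst (λ k → Choosable (KAdj m k) s) (*-identityʳ (suc κ))
    (choosable-split κ 0 s 0 1 z≤n (subst₂ _<_ lhs rhs small) choosable-one-part)
    where
    lhs : suc κ * m * κ ^ s ≡ suc κ * 1 * m * (0 + κ * 1) ^ s
    lhs = sym (cong₂ (λ a b → a * m * b ^ s) (*-identityʳ (suc κ)) (*-identityʳ κ))
    rhs : suc κ ^ s ≡ suc κ ^ s * (1 * 1 ^ s)
    rhs = sym (trans (cong (suc κ ^ s *_) (trans (*-identityˡ _) (^-zeroˡ s))) (*-identityʳ _))

  -- In the partition of the colours into two halves, a colour of L v counts with weight η if it lands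
  -- in the half of v and with weight η + 2 otherwise.
  choosable-double : ∀ {m k} η s u → s ≤ η * (2 + η) * u → 2 * k * m < 2 ^ u →
    .{{NonZero s}} → Choosable (KAdj m k) s → Choosable (KAdj m (2 * k)) (2 * s + suc η * (3 * u))
  choosable-double {m} {k} η (suc s) u s≤ few choosable =
    subst (Choosable (KAdj m (2 * k))) (split-size s e) (choosable-split 1 s w η (2 + η) (m≤n+m η 2) small choosable)
    where
    open ≤-Reasoning
    h = suc η
    e = h * (3 * u)
    w = suc (suc s + e)
    S = s + w
    split-size : ∀ s e → s + suc (suc s + e) ≡ 2 * suc s + e
    split-size = solve-∀
    h²≡ : h * h ≡ suc (η * (2 + η))
    h²≡ = lemma η
      where
      lemma : ∀ η → suc η * suc η ≡ suc (η * (2 + η))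
      lemma = solve-∀
    -- The mean weight `h` barely exceeds the geometric mean of the two weights: h^2 = η (η + 2) +
    -- 1, a loss of at most 4^u over `suc s` pairs of colours. Together with 2^u for the vertices
    -- this makes 8^u, supplied by the `e` extra colours, each gaining (η + 2)/h.
    core : 2 * k * m * h ^ S < η ^ s * (2 + η) ^ w
    core = begin-strict
      2 * k * m * h ^ S                                    <⟨ *-monoˡ-< (h ^ S) {{m^n≢0 h S}} few ⟩
      2 ^ u * h ^ S                                        ≡⟨ cong (λ z → 2 ^ u * h ^ z) (trans (split-size s e) (cong (λ z → suc s + z + e) (+-identityʳ (suc s)))) ⟩
      2 ^ u * h ^ (suc s + suc s + e)                      ≡⟨ cong (2 ^ u *_) (trans (^-distribˡ-+-* h (suc s + suc s) e) (cong (_* h ^ e) (trans (^-distribˡ-+-* h (suc s) (suc s)) (sym (^-distribʳ-* (suc s) h h))))) ⟩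
      2 ^ u * ((h * h) ^ suc s * h ^ e)                    ≡⟨ cong (λ z → 2 ^ u * (z ^ suc s * h ^ e)) h²≡ ⟩
      2 ^ u * (suc (η * (2 + η)) ^ suc s * h ^ e)          ≤⟨ *-monoʳ-≤ (2 ^ u) (*-monoˡ-≤ (h ^ e) (pow-ratio≤4^ (η * (2 + η)) (suc s) u s≤)) ⟩
      2 ^ u * (4 ^ u * (η * (2 + η)) ^ suc s * h ^ e)      ≡⟨ cong₂ (λ a b → 2 ^ u * (a * b * h ^ e)) (^-distribʳ-* u 2 2) (^-distribʳ-* (suc s) η (2 + η)) ⟩
      2 ^ u * (2 ^ u * 2 ^ u * (η ^ suc s * (2 + η) ^ suc s) * h ^ e) ≡⟨ regroup (2 ^ u) (η ^ suc s) ((2 + η) ^ suc s) (h ^ e) ⟩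
      2 ^ u * 2 ^ u * 2 ^ u * h ^ e * (η ^ suc s * (2 + η) ^ suc s)   ≡⟨ cong (λ z → z * h ^ e * (η ^ suc s * (2 + η) ^ suc s)) 2^3u ⟨
      2 ^ (3 * u) * h ^ e * (η ^ suc s * (2 + η) ^ suc s)  ≤⟨ *-monoˡ-≤ _ (double-pow-iterate h h (3 * u) ≤-refl) ⟩
      (2 + η) ^ e * (η ^ suc s * (2 + η) ^ suc s)          ≡⟨ regroup′ ((2 + η) ^ e) η (η ^ s) ((2 + η) ^ suc s) ⟩
      η ^ s * (η * ((2 + η) ^ suc s * (2 + η) ^ e))        ≡⟨ cong (λ z → η ^ s * (η * z)) (^-distribˡ-+-* (2 + η) (suc s) e) ⟨
      η ^ s * (η * (2 + η) ^ (suc s + e))                  ≤⟨ *-monoʳ-≤ (η ^ s) (*-monoˡ-≤ ((2 + η) ^ (suc s + e)) (m≤n+m η 2)) ⟩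
      η ^ s * (2 + η) ^ w                                  ∎
      where
      regroup : ∀ a b c d → a * (a * a * (b * c) * d) ≡ a * a * a * d * (b * c)
      regroup = solve-∀
      regroup′ : ∀ a η b c → a * (η * b * c) ≡ b * (η * (c * a))
      regroup′ = solve-∀
      2^3u : 2 ^ (3 * u) ≡ 2 ^ u * 2 ^ u * 2 ^ u
      2^3u = trans (cong (2 ^_) (3*≡ u)) (trans (^-distribˡ-+-* 2 (u + u) u) (cong (_* 2 ^ u) (^-distribˡ-+-* 2 u u)))
        where
        3*≡ : ∀ u → 3 * u ≡ u + u + u
        3*≡ = solve-∀
    small : 2 * k * m * (η + 1 * (2 + η)) ^ S < 2 ^ S * (η ^ s * (2 + η) ^ w)
    small = begin-strict
      2 * k * m * (η + 1 * (2 + η)) ^ S     ≡⟨ cong (λ z → 2 * k * m * z ^ S) (2h η) ⟩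
      2 * k * m * (2 * h) ^ S               ≡⟨ cong (2 * k * m *_) (^-distribʳ-* S 2 h) ⟩
      2 * k * m * (2 ^ S * h ^ S)           ≡⟨ regroup (2 * k * m) (2 ^ S) (h ^ S) ⟩
      2 ^ S * (2 * k * m * h ^ S)           <⟨ *-monoʳ-< (2 ^ S) {{m^n≢0 2 S}} core ⟩
      2 ^ S * (η ^ s * (2 + η) ^ w)         ∎
      where
      2h : ∀ η → η + 1 * (2 + η) ≡ 2 * suc η
      2h = solve-∀
      regroup : ∀ a b c → a * (b * c) ≡ b * (a * c)
      regroup = solve-∀

  -- The j-th doubling needs lists of length of order c g^2 with `c` linear and `g` quadratic in j:
  -- five linear factors, to be dominated by 2^j.
  fifth-power : ℕ → ℕ
  fifth-power n = n * n * n * n * n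

  -- From n = 7 on, (1 + 1/n)^5 ≤ 2. After the substitution n = 7 + p the difference 2 n^5 - (n +
  -- 1)^5 has only positive coefficients.
  fifth-power-growth : ∀ n j → 7 ≤ n → fifth-power (n + j) ≤ 2 ^ j * fifth-power n
  fifth-power-growth n zero _ = ≤-reflexive (trans (cong fifth-power (+-identityʳ n)) (sym (*-identityˡ _)))
  fifth-power-growth n (suc j) 7≤n = begin
    fifth-power (n + suc j)           ≡⟨ cong fifth-power (+-suc n j) ⟩
    fifth-power (suc (n + j))         ≤⟨ step (≤-trans 7≤n (m≤m+n n j)) ⟩
    2 * fifth-power (n + j)           ≤⟨ *-monoʳ-≤ 2 (fifth-power-growth n j 7≤n) ⟩
    2 * (2 ^ j * fifth-power n)       ≡⟨ *-assoc 2 (2 ^ j) _ ⟨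
    2 ^ suc j * fifth-power n         ∎
    where
    open ≤-Reasoning
    remainder : ℕ → ℕ
    remainder p = p * p * p * p * p + 30 * (p * p * p * p) + 340 * (p * p * p) + 1740 * (p * p) + 3530 * p + 846
    lemma : ∀ p → suc (7 + p) * suc (7 + p) * suc (7 + p) * suc (7 + p) * suc (7 + p)
                + (p * p * p * p * p + 30 * (p * p * p * p) + 340 * (p * p * p) + 1740 * (p * p) + 3530 * p + 846)
                ≡ 2 * ((7 + p) * (7 + p) * (7 + p) * (7 + p) * (7 + p))
    lemma = solve-∀
    step : ∀ {n} → 7 ≤ n → fifth-power (suc n) ≤ 2 * fifth-power n
    step 7≤n with m≤n⇒∃[o]m+o≡n 7≤n
    ... | p , refl = m+n≤o⇒m≤o (fifth-power (suc (7 + p))) {remainder p} (≤-reflexive (lemma p))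

  -- Doubling with η + 1 = 6 g lengthens the lists, relative to the number of parts, by a factor at
  -- most 1 + 1/g; for g = n (n + 2) the product of these factors telescopes.
  choosable-double-economic : ∀ {m k s} n c → .{{NonZero n}} →
    let g = n * (n + 2) in
    2 ≤ c → 2 * k * m < 2 ^ c → c * (18 * (g * g)) ≤ s → Choosable (KAdj m k) s →
    ∃ λ s′ → Choosable (KAdj m (2 * k)) s′ × 2 * s ≤ s′ × s′ * (n * (n + 2)) ≤ 2 * s * (suc n * suc n)
  choosable-double-economic {m} {k} {s} n c 2≤c few long choosable =
    2 * s + suc η * (3 * u) ,
    choosable-double η s u s≤ (<-≤-trans few (^-monoʳ-≤ 2 c≤u)) {{s≢0}} choosable ,
    m≤m+n (2 * s) _ , economic
    where
    open ≤-Reasoning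
    g = n * (n + 2)
    η = pred (6 * g)
    G = 18 * (g * g)
    g≢0 : NonZero g
    g≢0 = m*n≢0 n (n + 2) {{it}} {{>-nonZero (m≤n⇒m≤o+n n (s≤s z≤n))}}
    gg≢0 : NonZero (g * g)
    gg≢0 = m*n≢0 g g {{g≢0}} {{g≢0}}
    instance
      G≢0 : NonZero G
      G≢0 = m*n≢0 18 (g * g) {{it}} {{gg≢0}}
    -- As 2 G = (η + 1)^2, this is about twice the least `u` with s ≤ η (2 + η) u, which leaves room
    -- for rounding; the overhead 3 (η + 1) u = 18 g u is still at most s/g.
    u = s / G
    s≢0 : NonZero s
    s≢0 = >-nonZero (≤-trans (*-mono-≤ (≤-trans (s≤s z≤n) 2≤c) (>-nonZero⁻¹ G)) long)
    h≡ : suc η ≡ 6 * g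
    h≡ = suc-pred (6 * g) {{m*n≢0 6 g {{it}} {{g≢0}}}}
    c≤u : c ≤ u
    c≤u = s≤s⁻¹ (*-cancelʳ-< G c (suc u) (≤-<-trans long (m<[1+m/n]*n s G)))
    uG≤s : u * G ≤ s
    uG≤s = m/n*n≤m s G
    ηη+u : η * (2 + η) * u + u ≡ u * G + u * G
    ηη+u = trans (lemma η u) (trans (cong (λ h → h * h * u) h≡) (lemma′ g u))
      where
      lemma : ∀ η u → η * (2 + η) * u + u ≡ suc η * suc η * u
      lemma = solve-∀
      lemma′ : ∀ g u → (6 * g) * (6 * g) * u ≡ u * (18 * (g * g)) + u * (18 * (g * g))
      lemma′ = solve-∀
    G+u≤uG : ∀ {u G} → 2 ≤ u → 2 ≤ G → G + u ≤ u * G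
    G+u≤uG {suc (suc a)} {suc (suc b)} (s≤s (s≤s _)) (s≤s (s≤s _)) = ≤-trans (m≤m+n _ (a + b + a * b)) (≤-reflexive (lemma a b))
      where
      lemma : ∀ a b → 2 + b + (2 + a) + (a + b + a * b) ≡ (2 + a) * (2 + b)
      lemma = solve-∀
    s≤ : s ≤ η * (2 + η) * u
    s≤ = +-cancelʳ-≤ u _ _ (begin
      s + u                     ≤⟨ +-monoˡ-≤ u (<⇒≤ (m<[1+m/n]*n s G)) ⟩
      G + u * G + u             ≡⟨ lemma G u ⟩
      u * G + (G + u)           ≤⟨ +-monoʳ-≤ (u * G) (G+u≤uG {u} {G} (≤-trans 2≤c c≤u) (*-mono-≤ {2} {18} {1} {g * g} (s≤s (s≤s z≤n)) (>-nonZero⁻¹ (g * g) {{gg≢0}}))) ⟩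
      u * G + u * G             ≡⟨ ηη+u ⟨
      η * (2 + η) * u + u       ∎)
      where
      lemma : ∀ G u → G + u * G + u ≡ u * G + (G + u)
      lemma = solve-∀
    economic : (2 * s + suc η * (3 * u)) * g ≤ 2 * s * (suc n * suc n)
    economic = begin
      (2 * s + suc η * (3 * u)) * g        ≡⟨ cong (λ h → (2 * s + h * (3 * u)) * g) h≡ ⟩
      (2 * s + 6 * g * (3 * u)) * g        ≡⟨ lemma s g u ⟩
      2 * s * g + u * G                    ≤⟨ +-monoʳ-≤ (2 * s * g) (≤-trans uG≤s (m≤m+n s _)) ⟩
      2 * s * g + 2 * s                    ≡⟨ lemma′ s n ⟩
      2 * s * (suc n * suc n)              ∎
      where
      lemma : ∀ s g u → (2 * s + 6 * g * (3 * u)) * g ≡ 2 * s * g + u * (18 * (g * g))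
      lemma = solve-∀
      lemma′ : ∀ s n → 2 * s * (n * (n + 2)) + 2 * s ≡ 2 * s * (suc n * suc n)
      lemma′ = solve-∀

  m+n≢0 : ∀ m n → .{{NonZero m}} → NonZero (m + n)
  m+n≢0 (suc m) n = _

  -- The invariant comes from the telescoping product (H+1)²/(H(H+2)) · (H+2)²/((H+1)(H+3)) ⋯ ≤ (H+1)/H.
  choosable-doublings : ∀ {m} H M κ s₀ y → .{{NonZero H}} → 7 ≤ M → 3 + H ≤ M →
    36 * fifth-power M ≤ κ → suc κ * m < 4 ^ (2 + y) → suc y * κ ≤ s₀ → Choosable (KAdj m (suc κ)) s₀ →
    ∀ j → ∃ λ s → Choosable (KAdj m (2 ^ j * suc κ)) s × 2 ^ j * s₀ ≤ s ×
                  s * (H * suc (H + j)) ≤ 2 ^ j * s₀ * (suc H * (H + j))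
  choosable-doublings {m} H M κ s₀ y 7≤M 3+H≤M κ-large few s₀-large choosable zero =
    s₀ , subst (λ k → Choosable (KAdj m k) s₀) (sym (*-identityˡ (suc κ))) choosable , ≤-reflexive (*-identityˡ s₀) ,
    ≤-reflexive (lemma s₀ H)
    where
    lemma : ∀ s H → s * (H * suc (H + 0)) ≡ 1 * s * (suc H * (H + 0))
    lemma = solve-∀
  choosable-doublings {m} H M κ s₀ y 7≤M 3+H≤M κ-large few s₀-large choosable (suc j) =
    next (choosable-doublings H M κ s₀ y 7≤M 3+H≤M κ-large few s₀-large choosable j)
    where
    open ≤-Reasoning
    n = H + j
    g = n * (n + 2)
    few′ : 2 * (2 ^ j * suc κ) * m < 2 ^ (suc j + 2 * (2 + y))
    few′ = begin-strict
      2 * (2 ^ j * suc κ) * m            ≡⟨ lemma (2 ^ j) (suc κ) m ⟩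
      2 ^ suc j * (suc κ * m)            <⟨ *-monoʳ-< (2 ^ suc j) {{m^n≢0 2 (suc j)}} few ⟩
      2 ^ suc j * 4 ^ (2 + y)            ≡⟨ cong (2 ^ suc j *_) (^-*-assoc 2 2 (2 + y)) ⟩
      2 ^ suc j * 2 ^ (2 * (2 + y))      ≡⟨ ^-distribˡ-+-* 2 (suc j) (2 * (2 + y)) ⟨
      2 ^ (suc j + 2 * (2 + y))          ∎
      where
      lemma : ∀ a k m → 2 * (a * k) * m ≡ 2 * a * (k * m)
      lemma = solve-∀
    3+n≤ : 3 + n ≤ M + j
    3+n≤ = +-monoˡ-≤ j 3+H≤M
    n+2≤ : n + 2 ≤ M + j
    n+2≤ = ≤-trans (≤-reflexive (+-comm n 2)) (≤-trans (n≤1+n (2 + n)) 3+n≤)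
    n≤ : n ≤ M + j
    n≤ = ≤-trans (m≤m+n n 2) n+2≤
    3+j≤ : 3 + j ≤ M + j
    3+j≤ = +-monoˡ-≤ j (≤-trans (m≤m+n 3 H) 3+H≤M)
    next : (∃ λ s → Choosable (KAdj m (2 ^ j * suc κ)) s × 2 ^ j * s₀ ≤ s ×
              s * (H * suc (H + j)) ≤ 2 ^ j * s₀ * (suc H * (H + j))) →
           ∃ λ s → Choosable (KAdj m (2 ^ suc j * suc κ)) s × 2 ^ suc j * s₀ ≤ s ×
               s * (H * suc (H + suc j)) ≤ 2 ^ suc j * s₀ * (suc H * (H + suc j))
    next (s , choosable-s , s-large , s-small) =
      s′ , subst (λ k → Choosable (KAdj m k) s′) (sym (*-assoc 2 (2 ^ j) (suc κ))) choosable-s′ ,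
      ≤-trans (≤-reflexive (*-assoc 2 (2 ^ j) s₀)) (≤-trans (*-monoʳ-≤ 2 s-large) s′-large) , *-cancelʳ-≤ _ _ n {{m+n≢0 H j}} (begin
        s′ * (H * suc (H + suc j)) * n                   ≡⟨ lemma s′ H j ⟩
        s′ * (n * (n + 2)) * H                           ≤⟨ *-monoˡ-≤ H s′-small ⟩
        2 * s * (suc n * suc n) * H                      ≡⟨ lemma₁ s n H ⟩
        2 * (s * (H * suc n)) * suc n                    ≤⟨ *-monoˡ-≤ (suc n) (*-monoʳ-≤ 2 s-small) ⟩
        2 * (2 ^ j * s₀ * (suc H * n)) * suc n           ≡⟨ lemma₂ (2 ^ j) s₀ H j ⟩
        2 ^ suc j * s₀ * (suc H * (H + suc j)) * n       ∎)
      where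
      -- Bounding the exponent by (2 + y)(3 + j) separates the variables: the five factors depending
      -- on `j` are absorbed by 2^j κ, and 2 + y by s₀ ≥ (y + 1) κ.
      long : (suc j + 2 * (2 + y)) * (18 * (g * g)) ≤ s
      long = *-cancelˡ-≤ 2 (begin
        2 * ((suc j + 2 * (2 + y)) * (18 * (g * g)))     ≤⟨ *-monoʳ-≤ 2 (*-monoˡ-≤ (18 * (g * g)) (≤-trans (m≤m+n (suc j + 2 * (2 + y)) (suc j + j * y + y)) (≤-reflexive (lemma j y)))) ⟩
        2 * ((2 + y) * (3 + j) * (18 * (g * g)))         ≡⟨ lemma₁ (2 + y) (3 + j) n ⟩
        36 * (n * (n + 2) * n * (n + 2) * (3 + j)) * (2 + y)
          ≤⟨ *-monoˡ-≤ (2 + y) (*-monoʳ-≤ 36 (*-mono-≤ (*-mono-≤ (*-mono-≤ (*-mono-≤ n≤ n+2≤) n≤) n+2≤) 3+j≤)) ⟩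
        36 * fifth-power (M + j) * (2 + y)                   ≤⟨ *-monoˡ-≤ (2 + y) (*-monoʳ-≤ 36 (fifth-power-growth M j 7≤M)) ⟩
        36 * (2 ^ j * fifth-power M) * (2 + y)    ≡⟨ lemma₂ (2 ^ j) (fifth-power M) (2 + y) ⟩
        2 ^ j * (36 * fifth-power M) * (2 + y)    ≤⟨ *-mono-≤ (*-monoʳ-≤ (2 ^ j) κ-large) (m≤m+n (2 + y) y) ⟩
        2 ^ j * κ * (2 + y + y)                          ≡⟨ lemma₃ (2 ^ j) κ y ⟩
        2 * (2 ^ j * (suc y * κ))                        ≤⟨ *-monoʳ-≤ 2 (*-monoʳ-≤ (2 ^ j) s₀-large) ⟩
        2 * (2 ^ j * s₀)                                 ≤⟨ *-monoʳ-≤ 2 s-large ⟩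
        2 * s                                            ∎)
        where
        lemma : ∀ j y → suc j + 2 * (2 + y) + (suc j + j * y + y) ≡ (2 + y) * (3 + j)
        lemma = solve-∀
        lemma₁ : ∀ y j n → 2 * (y * j * (18 * (n * (n + 2) * (n * (n + 2))))) ≡ 36 * (n * (n + 2) * n * (n + 2) * j) * y
        lemma₁ = solve-∀
        lemma₂ : ∀ a b c → 36 * (a * b) * c ≡ a * (36 * b) * c
        lemma₂ = solve-∀
        lemma₃ : ∀ a κ y → a * κ * (2 + y + y) ≡ 2 * (a * (suc y * κ))
        lemma₃ = solve-∀
      doubled = choosable-double-economic n (suc j + 2 * (2 + y)) {{m+n≢0 H j}}
        (≤-trans (s≤s (s≤s z≤n)) (m≤n+m (2 * (2 + y)) (suc j))) few′ long choosable-s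
      s′ = proj₁ doubled
      choosable-s′ = proj₁ (proj₂ doubled)
      s′-large = proj₁ (proj₂ (proj₂ doubled))
      s′-small = proj₂ (proj₂ (proj₂ doubled))
      lemma : ∀ s H j → s * (H * suc (H + suc j)) * (H + j) ≡ s * ((H + j) * ((H + j) + 2)) * H
      lemma = solve-∀
      lemma₁ : ∀ s n H → 2 * s * (suc n * suc n) * H ≡ 2 * (s * (H * suc n)) * suc n
      lemma₁ = solve-∀
      lemma₂ : ∀ a s H j → 2 * (a * s * (suc H * (H + j))) * suc (H + j) ≡ 2 * a * s * (suc H * (H + suc j)) * (H + j)
      lemma₂ = solve-∀

  -- Upper bound: starting point of the doublings and final estimate

  n<2^n : ∀ n → n < 2 ^ n
  n<2^n zero = s≤s z≤n
  n<2^n (suc n) = subst (suc (suc n) ≤_) (cong (2 ^ n +_) (sym (+-identityʳ (2 ^ n))))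
    (≤-trans (s≤s (n<2^n n)) (+-monoˡ-≤ (2 ^ n) (m^n>0 2 n)))

  -- Take `j` with K 2^j ≤ k < K 2^(j+1) and let `κ` be k/2^j rounded down. Passing to κ + 1 adds
  -- 2^j parts, at most k/K.
  dyadic-approximation : ∀ K k → .{{NonZero K}} → K ≤ k →
    ∃ λ j → ∃ λ κ → K ≤ κ × κ < 2 * K × k ≤ 2 ^ j * suc κ × K * (2 ^ j * suc κ) ≤ suc K * k
  dyadic-approximation K k K≤k with threshold (λ j → k <? K * 2 ^ j) {k}
    (λ k<K → <⇒≱ k<K (≤-trans (≤-reflexive (*-identityʳ K)) K≤k))
    (<-≤-trans (n<2^n k) (subst (_≤ K * 2 ^ k) (*-identityˡ (2 ^ k)) (*-monoˡ-≤ (2 ^ k) (>-nonZero⁻¹ K))))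
  ... | j , k≮ , k< = j , κ , s≤s⁻¹ (*-cancelʳ-< (2 ^ j) K (suc κ) (≤-<-trans K2ʲ≤k k<′)) ,
    *-cancelʳ-< (2 ^ j) κ (2 * K) (≤-<-trans κ2ʲ≤k (subst (k <_) (lemma K (2 ^ j)) k<)) ,
    <⇒≤ (subst (k <_) (*-comm (suc κ) (2 ^ j)) k<′) ,
    (begin
      K * (2 ^ j * suc κ)              ≡⟨ lemma′ K (2 ^ j) κ ⟩
      K * 2 ^ j + K * (κ * 2 ^ j)      ≤⟨ +-mono-≤ K2ʲ≤k (*-monoʳ-≤ K κ2ʲ≤k) ⟩
      suc K * k                        ∎)
    where
    open ≤-Reasoning
    instance
      2ʲ≢0 : NonZero (2 ^ j)
      2ʲ≢0 = m^n≢0 2 j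
    κ = k / 2 ^ j
    k<′ = m<[1+m/n]*n k (2 ^ j)
    κ2ʲ≤k = m/n*n≤m k (2 ^ j)
    K2ʲ≤k : K * 2 ^ j ≤ k
    K2ʲ≤k = ≮⇒≥ k≮
    lemma : ∀ K a → K * (2 * a) ≡ 2 * K * a
    lemma = solve-∀
    lemma′ : ∀ K a κ → K * (a * suc κ) ≡ K * a + K * (κ * a)
    lemma′ = solve-∀

  first-moment-threshold : ∀ κ m → .{{NonZero κ}} → .{{NonZero m}} →
    ∃ λ p → suc κ ^ p ≤ suc κ * m * κ ^ p × suc κ * m * κ ^ suc p < suc κ ^ suc p
  first-moment-threshold κ m with threshold (λ s → suc κ * m * κ ^ s <? suc κ ^ s) {κ * (suc κ * m)}
    (λ few → <⇒≱ few (*-mono-≤ (>-nonZero⁻¹ (suc κ * m) {{m*n≢0 (suc κ) m}}) (≤-refl {1})))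
    (<-≤-trans (*-monoˡ-< (κ ^ (κ * (suc κ * m))) {{m^n≢0 κ (κ * (suc κ * m))}} (n<2^n (suc κ * m))) (double-pow-iterate κ κ (suc κ * m) ≤-refl))
  ... | p , ¬few , few = p , ≮⇒≥ ¬few , few

  -- Here ln (κ + 1) becomes negligible: κ + 1 ≤ m^(1/H) gives ((κ + 1)/κ)^p ≤ m^(1 + 1/H), and n ≤
  -- p H/(H + 1). Comparing (H + 1)-st powers avoids roots.
  pow-root : ∀ κ m p n H → .{{NonZero κ}} → suc κ ^ p ≤ suc κ * m * κ ^ p → suc κ ^ H ≤ m → n * suc H ≤ p * H →
             suc κ ^ n ≤ m * κ ^ n
  pow-root κ m p n H p-bound m-large n≤ with m≤n⇒∃[o]m+o≡n n≤
  ... | z , eq = ^-cancelˡ-≤ H _ _ (*-cancelʳ-≤ _ _ (suc κ ^ z) {{m^n≢0 (suc κ) z}} (begin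
    (suc κ ^ n) ^ suc H * suc κ ^ z                ≡⟨ collect (suc κ) ⟩
    (suc κ ^ p) ^ H                                ≤⟨ ^-monoˡ-≤ H p-bound ⟩
    (suc κ * m * κ ^ p) ^ H                        ≡⟨ trans (^-distribʳ-* H (suc κ * m) (κ ^ p)) (cong (_* (κ ^ p) ^ H) (^-distribʳ-* H (suc κ) m)) ⟩
    suc κ ^ H * m ^ H * (κ ^ p) ^ H                ≤⟨ *-monoˡ-≤ ((κ ^ p) ^ H) (*-monoˡ-≤ (m ^ H) m-large) ⟩
    m * m ^ H * (κ ^ p) ^ H                        ≡⟨ cong (m * m ^ H *_) (collect κ) ⟨
    m * m ^ H * ((κ ^ n) ^ suc H * κ ^ z)          ≡⟨ trans (sym (*-assoc (m ^ suc H) _ _)) (cong (_* κ ^ z) (sym (^-distribʳ-* (suc H) m (κ ^ n)))) ⟩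
    (m * κ ^ n) ^ suc H * κ ^ z                    ≤⟨ *-monoʳ-≤ ((m * κ ^ n) ^ suc H) (^-monoˡ-≤ z (n≤1+n κ)) ⟩
    (m * κ ^ n) ^ suc H * suc κ ^ z                ∎))
    where
    open ≤-Reasoning
    collect : ∀ a → (a ^ n) ^ suc H * a ^ z ≡ (a ^ p) ^ H
    collect a = trans (cong (_* a ^ z) (^-*-assoc a n (suc H))) (trans (sym (^-distribˡ-+-* a (n * suc H) z)) (trans (cong (a ^_) eq) (sym (^-*-assoc a p H))))

  module _ (d H M K : ℕ) .{{_ : NonZero H}} (7≤M : 7 ≤ M) (3+H≤M : 3 + H ≤ M)
           (K≥fifth : 36 * fifth-power M ≤ K) (K-large : 2 + 2 * H ≤ K)
           (H-ratio : d * (suc H * suc H * suc H * suc H) ≤ suc d * (H * H * H * H)) where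

    -- Four losses of a factor 1 + 1/H each: the growth of the lists during the doublings, the
    -- rounding of `k`, p + 1 against p - 1, and p - 1 against `n`. `H-ratio` fits their product
    -- into 1 + 1/d.
    choosable-upper : ∀ m k → (2 * K) ^ H + K ≤ m → K ≤ k → ∃ λ s → ∃ λ n → ∃ λ κ′ → let κ = suc κ′ in
      Choosable (KAdj m k) s × suc κ ^ n ≤ m * κ ^ n × s * suc κ * d ≤ n * suc d * k
    choosable-upper m k N≤m K≤k = from-parts (dyadic-approximation K k {{>-nonZero (≤-trans (s≤s z≤n) K-large)}} K≤k)
      where
      open ≤-Reasoning
      Goal : Set
      Goal = ∃ λ s → ∃ λ n → ∃ λ κ′ → let κ = suc κ′ in
        Choosable (KAdj m k) s × suc κ ^ n ≤ m * κ ^ n × s * suc κ * d ≤ n * suc d * k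
      K≤m : K ≤ m
      K≤m = ≤-trans (m≤n+m K ((2 * K) ^ H)) N≤m
      m≥4 : 4 ≤ m
      m≥4 = ≤-trans (+-monoʳ-≤ 2 (*-monoʳ-≤ 2 (>-nonZero⁻¹ H))) (≤-trans K-large K≤m)
      module _ (j κ′ : ℕ) (K≤κ : K ≤ suc κ′) (κ<2K : suc κ′ < 2 * K) (k≤ : k ≤ 2 ^ j * suc (suc κ′))
               (K*≤ : K * (2 ^ j * suc (suc κ′)) ≤ suc K * k) (p : ℕ)
               (p-bound : suc (suc κ′) ^ p ≤ suc (suc κ′) * m * suc κ′ ^ p)
               (few : suc (suc κ′) * m * suc κ′ ^ suc p < suc (suc κ′) ^ suc p) where
        κ : ℕ
        κ = suc κ′
        -- Since (1 + 1/κ)^κ ≤ 4, the κ + 1 parts have fewer than 4^(y+1) vertices, while y κ ≤ p +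
        -- 1; these are the two conditions for starting the doublings.
        y : ℕ
        y = suc p / κ
        few-parts′ : suc κ * m < 4 ^ suc y
        few-parts′ = *-cancelʳ-< (κ ^ suc p) (suc κ * m) (4 ^ suc y)
          (<-≤-trans few (pow-ratio≤4^ κ (suc p) (suc y) (subst (suc p ≤_) (*-comm (suc y) κ) (<⇒≤ (m<[1+m/n]*n (suc p) κ)))))
        y≢0 : y ≢ 0
        y≢0 y≡0 = <⇒≱ (subst (λ y → suc κ * m < 4 ^ suc y) y≡0 few-parts′) (≤-trans m≥4 (m≤n*m m (suc κ)))
        y-2 : ℕ
        y-2 = pred y
        y≡ : suc y-2 ≡ y
        y≡ = suc-pred y {{≢-nonZero y≢0}}
        few-parts : suc κ * m < 4 ^ (2 + y-2)
        few-parts = subst (λ y → suc κ * m < 4 ^ suc y) (sym y≡) few-parts′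
        s₀-large : suc y-2 * κ ≤ suc p
        s₀-large = subst (λ y → y * κ ≤ suc p) (sym y≡) (m/n*n≤m (suc p) κ)
        p-large : 1 + 2 * H ≤ p
        p-large = s≤s⁻¹ (≤-trans K-large (≤-trans K≤κ (≤-trans (m≤m+n κ (y-2 * κ)) s₀-large)))
        n : ℕ
        n = p * H / suc H
        growth : suc κ ^ n ≤ m * κ ^ n
        growth = pow-root κ m p n H p-bound (≤-trans (^-monoˡ-≤ H κ<2K) (≤-trans (m≤m+n ((2 * K) ^ H) K) N≤m)) (m/n*n≤m (p * H) (suc H))
        p-1 : ℕ
        p-1 = pred p
        p≡ : suc p-1 ≡ p
        p≡ = suc-pred p {{>-nonZero (≤-trans (s≤s z≤n) p-large)}}
        p-bound₁ : suc p * H ≤ p-1 * suc H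
        p-bound₁ = begin
          suc p * H                ≡⟨ cong (λ p → suc p * H) p≡ ⟨
          suc (suc p-1) * H        ≡⟨ lemma p-1 H ⟩
          2 * H + p-1 * H          ≤⟨ +-monoˡ-≤ (p-1 * H) (s≤s⁻¹ (subst (1 + 2 * H ≤_) (sym p≡) p-large)) ⟩
          p-1 + p-1 * H            ≡⟨ *-suc p-1 H ⟨
          p-1 * suc H              ∎
          where
          lemma : ∀ p H → suc (suc p) * H ≡ 2 * H + p * H
          lemma = solve-∀
        -- Using p - 1 in place of `p` absorbs the rounding down of `n`.
        p-bound₂ : p-1 * H ≤ n * suc H
        p-bound₂ = +-cancelˡ-≤ H _ _ (s≤s⁻¹ (begin
          suc (suc p-1 * H)        ≡⟨ cong (λ p → suc (p * H)) p≡ ⟩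
          suc (p * H)              ≤⟨ m<[1+m/n]*n (p * H) (suc H) ⟩
          suc n * suc H            ∎))
        k-bound : H * (2 ^ j * suc κ) ≤ suc H * k
        k-bound with m≤n⇒∃[o]m+o≡n k≤
        ... | δ , eq = begin
          H * (2 ^ j * suc κ)      ≡⟨ cong (H *_) eq ⟨
          H * (k + δ)              ≡⟨ *-distribˡ-+ H k δ ⟩
          H * k + H * δ            ≤⟨ +-monoʳ-≤ (H * k) (≤-trans (*-monoˡ-≤ δ H≤K) Kδ≤k) ⟩
          H * k + k                ≡⟨ +-comm (H * k) k ⟩
          suc H * k                ∎
          where
          H≤K : H ≤ K
          H≤K = ≤-trans (≤-trans (m≤m+n H (H + 0)) (m≤n+m (2 * H) 2)) K-large
          Kδ≤k : K * δ ≤ k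
          Kδ≤k = +-cancelˡ-≤ (K * k) _ _ (begin
            K * k + K * δ          ≡⟨ *-distribˡ-+ K k δ ⟨
            K * (k + δ)            ≡⟨ cong (K *_) eq ⟩
            K * (2 ^ j * suc κ)    ≤⟨ K*≤ ⟩
            suc K * k              ≡⟨ +-comm k (K * k) ⟩
            K * k + k              ∎)
        finish : (∃ λ s → Choosable (KAdj m (2 ^ j * suc κ)) s × 2 ^ j * suc p ≤ s ×
                    s * (H * suc (H + j)) ≤ 2 ^ j * suc p * (suc H * (H + j))) → Goal
        finish (s , choosable , _ , s-small) = s , n , κ′ , choosable-antimono-parts k≤ choosable , growth , ratio
          where
          sH≤ : s * H ≤ 2 ^ j * suc p * suc H
          sH≤ = *-cancelʳ-≤ _ _ (suc (H + j)) (begin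
            s * H * suc (H + j)                        ≡⟨ *-assoc s H (suc (H + j)) ⟩
            s * (H * suc (H + j))                      ≤⟨ s-small ⟩
            2 ^ j * suc p * (suc H * (H + j))          ≤⟨ *-monoʳ-≤ (2 ^ j * suc p) (*-monoʳ-≤ (suc H) (n≤1+n (H + j))) ⟩
            2 ^ j * suc p * (suc H * suc (H + j))      ≡⟨ *-assoc (2 ^ j * suc p) (suc H) (suc (H + j)) ⟨
            2 ^ j * suc p * suc H * suc (H + j)        ∎)
          ratio : s * suc κ * d ≤ n * suc d * k
          ratio = *-cancelʳ-≤ _ _ (H * H * H * H) {{H⁴≢0}} (begin
            s * suc κ * d * (H * H * H * H)                          ≡⟨ lemma₁ s (suc κ) d H ⟩
            s * H * (suc κ * d * (H * H * H))                        ≤⟨ *-monoˡ-≤ _ sH≤ ⟩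
            2 ^ j * suc p * suc H * (suc κ * d * (H * H * H))        ≡⟨ lemma₂ (2 ^ j) (suc p) (suc H) (suc κ) d H ⟩
            H * (2 ^ j * suc κ) * (suc p * H) * (H * suc H * d)      ≤⟨ *-monoˡ-≤ (H * suc H * d) (*-mono-≤ k-bound p-bound₁) ⟩
            suc H * k * (p-1 * suc H) * (H * suc H * d)              ≡⟨ lemma₃ k p-1 H (suc H) d ⟩
            p-1 * H * (suc H * suc H * suc H * d * k)                ≤⟨ *-monoˡ-≤ _ p-bound₂ ⟩
            n * suc H * (suc H * suc H * suc H * d * k)              ≡⟨ lemma₄ n (suc H) d k ⟩
            n * k * (d * (suc H * suc H * suc H * suc H))            ≤⟨ *-monoʳ-≤ (n * k) H-ratio ⟩
            n * k * (suc d * (H * H * H * H))                        ≡⟨ lemma₅ n k (suc d) (H * H * H * H) ⟩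
            n * suc d * k * (H * H * H * H)                          ∎)
            where
            lemma₁ : ∀ s κ d H → s * κ * d * (H * H * H * H) ≡ s * H * (κ * d * (H * H * H))
            lemma₁ = solve-∀
            lemma₂ : ∀ a p H′ κ d H → a * p * H′ * (κ * d * (H * H * H)) ≡ H * (a * κ) * (p * H) * (H * H′ * d)
            lemma₂ = solve-∀
            lemma₃ : ∀ k p H H′ d → H′ * k * (p * H′) * (H * H′ * d) ≡ p * H * (H′ * H′ * H′ * d * k)
            lemma₃ = solve-∀
            lemma₄ : ∀ n H′ d k → n * H′ * (H′ * H′ * H′ * d * k) ≡ n * k * (d * (H′ * H′ * H′ * H′))
            lemma₄ = solve-∀
            lemma₅ : ∀ n k d e → n * k * (d * e) ≡ n * d * k * e
            lemma₅ = solve-∀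
            H⁴≢0 : NonZero (H * H * H * H)
            H⁴≢0 = m*n≢0 (H * H * H) H {{m*n≢0 (H * H) H {{m*n≢0 H H}}}}
        conclude : Goal
        conclude = finish (choosable-doublings H M κ (suc p) y-2 7≤M 3+H≤M (≤-trans K≥fifth K≤κ) few-parts s₀-large (choosable-first-moment κ (suc p) few) j)
      from-parts : (∃ λ j → ∃ λ κ → K ≤ κ × κ < 2 * K × k ≤ 2 ^ j * suc κ × K * (2 ^ j * suc κ) ≤ suc K * k) → Goal
      from-parts (j , zero , K≤0 , _) = contradiction (≤-trans K-large K≤0) λ ()
      from-parts (j , κ@(suc κ′) , K≤κ , κ<2K , k≤ , K*≤) =
        let p , p-bound , few = first-moment-threshold κ m {{_}} {{>-nonZero (≤-trans (s≤s z≤n) m≥4)}}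
        in conclude j κ′ K≤κ κ<2K k≤ K*≤ p p-bound few

  -- n / (κ + 1) is a lower estimate of ln m, so the bound is s ≤ (1 + 1/d) k ln m.
  choice-number-upper : ∀ d′ → let d = suc d′ in
    ∃ λ N → ∀ m k → N ≤ m → N ≤ k → ∃ λ s → ∃ λ n → ∃ λ κ′ → let κ = suc κ′ in
      Choosable (KAdj m k) s × suc κ ^ n ≤ m * κ ^ n × s * suc κ * d ≤ n * suc d * k
  choice-number-upper d′ = (2 * K) ^ H + K , λ m k N≤m N≤k →
    choosable-upper (suc d′) H (3 + H) K (≤-trans (m≤m+n 7 (4 + 8 * d′)) (≤-reflexive (lemma₁ d′))) ≤-refl ≤-refl
      (K-large H) (H-ratio d′) m k N≤m (≤-trans (m≤n+m K ((2 * K) ^ H)) N≤k)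
    where
    -- Chosen so that (1 + 1/H)^4 ≤ 1 + 1/d; `K` is then dictated by the fifth power in the
    -- doublings.
    H = 8 * suc d′
    K = 36 * fifth-power (3 + H)
    lemma₁ : ∀ d′ → 7 + (4 + 8 * d′) ≡ 3 + 8 * suc d′
    lemma₁ = solve-∀
    fifth≥ : ∀ n → .{{NonZero n}} → n ≤ fifth-power n
    fifth≥ n = m≤n*m n (n * n * n * n) {{m*n≢0 (n * n * n) n {{m*n≢0 (n * n) n {{m*n≢0 n n}}}}}}
    K-large : ∀ H → 2 + 2 * H ≤ 36 * fifth-power (3 + H)
    K-large H = ≤-trans (≤-trans (m≤m+n (2 + 2 * H) (106 + 34 * H)) (≤-reflexive (lemma H))) (*-monoʳ-≤ 36 (fifth≥ (3 + H)))
      where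
      lemma : ∀ H → 2 + 2 * H + (106 + 34 * H) ≡ 36 * (3 + H)
      lemma = solve-∀
    H-ratio : ∀ d′ → let d = suc d′; H = 8 * d in d * (suc H * suc H * suc H * suc H) ≤ suc d * (H * H * H * H)
    H-ratio d′ = ≤-trans (m≤m+n _ (1631 + 6975 * d′ + 11104 * (d′ * d′) + 7808 * (d′ * d′ * d′) + 2048 * (d′ * d′ * d′ * d′))) (≤-reflexive (lemma d′))
      where
      lemma : ∀ d′ → let d = suc d′; H = 8 * d in d * (suc H * suc H * suc H * suc H)
        + (1631 + 6975 * d′ + 11104 * (d′ * d′) + 7808 * (d′ * d′ * d′) + 2048 * (d′ * d′ * d′ * d′))
        ≡ suc d * (H * H * H * H)
      lemma = solve-∀

-- From powers of 1 + 1/κ to partial sums of the exponential series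

module Exponential where

  open import Data.Nat as ℕ using (ℕ; zero; suc)
  import Data.Nat.Properties as ℕ
  open import Data.Integer as ℤ using (+_)
  import Data.Integer.Properties as ℤ
  open import Data.Product using (_,_; ∃)
  open import Data.Rational
  open import Data.Rational.Properties
  open import Data.Rational.Solver using (module +-*-Solver)
  open +-*-Solver using (solve; con; _:=_; _:+_; _:*_; :-_)
  import Data.Rational.Unnormalised as ℚᵘ
  import Data.Rational.Unnormalised.Properties as ℚᵘ
  open import Relation.Binary.PropositionalEquality
  open import Relation.Nullary
  open import Relation.Nullary.Decidable using (from-yes)

  ι-mono : ∀ {a b} → a ℕ.≤ b → ι a ≤ ι b
  ι-mono {a} {b} a≤b = toℚᵘ-cancel-≤ (ℚᵘ.≤-respˡ-≃ (ℚᵘ.≃-sym (toℚᵘ-fromℚᵘ (ℚᵘ.mkℚᵘ (+ a) 0)))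
    (ℚᵘ.≤-respʳ-≃ (ℚᵘ.≃-sym (toℚᵘ-fromℚᵘ (ℚᵘ.mkℚᵘ (+ b) 0)))
      (ℚᵘ.*≤* (ℤ.*-monoʳ-≤-nonNeg (+ 1) (ℤ.+≤+ a≤b)))))

  fromℚᵘ-* : ∀ p q → fromℚᵘ p * fromℚᵘ q ≡ fromℚᵘ (p ℚᵘ.* q)
  fromℚᵘ-* p q = toℚᵘ-injective (ℚᵘ.≃-trans (toℚᵘ-homo-* (fromℚᵘ p) (fromℚᵘ q))
    (ℚᵘ.≃-trans (ℚᵘ.*-cong (toℚᵘ-fromℚᵘ p) (toℚᵘ-fromℚᵘ q)) (ℚᵘ.≃-sym (toℚᵘ-fromℚᵘ (p ℚᵘ.* q)))))

  fromℚᵘ-+ : ∀ p q → fromℚᵘ p + fromℚᵘ q ≡ fromℚᵘ (p ℚᵘ.+ q)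
  fromℚᵘ-+ p q = toℚᵘ-injective (ℚᵘ.≃-trans (toℚᵘ-homo-+ (fromℚᵘ p) (fromℚᵘ q))
    (ℚᵘ.≃-trans (ℚᵘ.+-cong (toℚᵘ-fromℚᵘ p) (toℚᵘ-fromℚᵘ q)) (ℚᵘ.≃-sym (toℚᵘ-fromℚᵘ (p ℚᵘ.+ q)))))

  ι-* : ∀ a b → ι (a ℕ.* b) ≡ ι a * ι b
  ι-* a b = sym (trans (fromℚᵘ-* (ℚᵘ.mkℚᵘ (+ a) 0) (ℚᵘ.mkℚᵘ (+ b) 0)) (cong (λ n → n / 1) (sym (ℤ.pos-* a b))))

  ι-suc : ∀ a → ι (suc a) ≡ ι a + 1ℚ
  ι-suc a = sym (trans (fromℚᵘ-+ (ℚᵘ.mkℚᵘ (+ a) 0) (ℚᵘ.mkℚᵘ (+ 1) 0))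
    (cong (λ n → n / 1) (trans (cong (ℤ._+ + 1) (ℤ.*-identityʳ (+ a))) (cong +_ (ℕ.+-comm a 1)))))

  0≤ι : ∀ a → 0ℚ ≤ ι a
  0≤ι a = ι-mono {0} {a} ℕ.z≤n

  0<ι : ∀ a → .{{ℕ.NonZero a}} → 0ℚ < ι a
  0<ι (suc a) = subst (0ℚ <_) (sym (ι-suc a)) (+-mono-≤-< (0≤ι a) (from-yes (0ℚ <? 1ℚ)))

  reciprocal : ∀ i → + 1 / suc i * ι (suc i) ≡ 1ℚ
  reciprocal i = trans (fromℚᵘ-* (ℚᵘ.mkℚᵘ (+ 1) i) (ℚᵘ.mkℚᵘ (+ suc i) 0))
    (fromℚᵘ-cong {x = ℚᵘ.mkℚᵘ (+ 1) i ℚᵘ.* ℚᵘ.mkℚᵘ (+ suc i) 0} {y = ℚᵘ.1ℚᵘ} (ℚᵘ.*≡* (begin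
      (+ 1 ℤ.* + suc i) ℤ.* + 1       ≡⟨ ℤ.*-assoc (+ 1) (+ suc i) (+ 1) ⟩
      + 1 ℤ.* (+ suc i ℤ.* + 1)       ≡⟨ cong (+ 1 ℤ.*_) (ℤ.pos-* (suc i) 1) ⟨
      + 1 ℤ.* + (suc i ℕ.* 1)         ∎)))
    where open ≡-Reasoning

  *-monoˡ : ∀ {p q r} → 0ℚ ≤ r → p ≤ q → r * p ≤ r * q
  *-monoˡ {r = r} 0≤r = *-monoˡ-≤-nonNeg r {{nonNegative 0≤r}}

  *-monoʳ : ∀ {p q r} → 0ℚ ≤ r → p ≤ q → p * r ≤ q * r
  *-monoʳ {r = r} 0≤r = *-monoʳ-≤-nonNeg r {{nonNegative 0≤r}}

  0≤* : ∀ {p q} → 0ℚ ≤ p → 0ℚ ≤ q → 0ℚ ≤ p * q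
  0≤* {p} {q} 0≤p 0≤q = subst (_≤ p * q) (*-zeroʳ p) (*-monoˡ 0≤p 0≤q)

  *-cancelʳ : ∀ {p q r} → 0ℚ < r → p * r ≤ q * r → p ≤ q
  *-cancelʳ {r = r} 0<r = *-cancelʳ-≤-pos r {{positive 0<r}}

  expTerm-suc : ∀ x i → expTerm x (suc i) * ι (suc i) ≡ x * expTerm x i
  expTerm-suc x i = begin
    expTerm x i * x * (+ 1 / suc i) * ι (suc i)     ≡⟨ *-assoc (expTerm x i * x) (+ 1 / suc i) (ι (suc i)) ⟩
    expTerm x i * x * ((+ 1 / suc i) * ι (suc i))   ≡⟨ cong (expTerm x i * x *_) (reciprocal i) ⟩
    expTerm x i * x * 1ℚ                            ≡⟨ *-identityʳ _ ⟩
    expTerm x i * x                                 ≡⟨ *-comm (expTerm x i) x ⟩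
    x * expTerm x i                                 ∎
    where open ≡-Reasoning

  0≤expTerm : ∀ {x} → 0ℚ ≤ x → ∀ i → 0ℚ ≤ expTerm x i
  0≤expTerm 0≤x zero = 0≤ι 1
  0≤expTerm {x} 0≤x (suc i) = *-cancelʳ (0<ι (suc i)) (subst₂ _≤_ (sym (*-zeroˡ (ι (suc i)))) (sym (expTerm-suc x i)) (0≤* 0≤x (0≤expTerm 0≤x i)))

  expTerm-mono : ∀ {x y} → 0ℚ ≤ x → x ≤ y → ∀ i → expTerm x i ≤ expTerm y i
  expTerm-mono 0≤x x≤y zero = ≤-refl
  expTerm-mono {x} {y} 0≤x x≤y (suc i) = *-cancelʳ (0<ι (suc i)) (subst₂ _≤_ (sym (expTerm-suc x i)) (sym (expTerm-suc y i))
    (≤-trans (*-monoˡ 0≤x (expTerm-mono 0≤x x≤y i)) (*-monoʳ (0≤expTerm (≤-trans 0≤x x≤y) i) x≤y)))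

  expPartial-mono : ∀ {x y} → 0ℚ ≤ x → x ≤ y → ∀ N → expPartial x N ≤ expPartial y N
  expPartial-mono 0≤x x≤y zero = ≤-refl
  expPartial-mono 0≤x x≤y (suc N) = +-mono-≤ (expPartial-mono 0≤x x≤y N) (expTerm-mono 0≤x x≤y N)

  module _ {y u : ℚ} (0≤y : 0ℚ ≤ y) (0≤u : 0ℚ ≤ u) where
    private
      T T⁺ : ℕ → ℚ
      T = expTerm y
      T⁺ = expTerm (y + u)
      y≤y+u : y ≤ y + u
      y≤y+u = subst (_≤ y + u) (+-identityʳ y) (+-mono-≤ (≤-refl {y}) 0≤u)
      0≤y+u : 0ℚ ≤ y + u
      0≤y+u = ≤-trans 0≤y y≤y+u

    -- The mean value estimate for t^(i+1)/(i+1)!, whose derivative is t^i/i!, taken at the right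
    -- end; `expTerm-shift-≥` takes the left end. Induction through the recursion of the terms
    -- avoids binomial sums.
    expTerm-shift-≤ : ∀ i → T⁺ (suc i) ≤ T (suc i) + u * T⁺ i
    expTerm-shift-≤ zero = ≤-reflexive (solve 2 (λ y u → con 1ℚ :* (y :+ u) :* con 1ℚ := con 1ℚ :* y :* con 1ℚ :+ u :* con 1ℚ) refl y u)
    expTerm-shift-≤ (suc i) = *-cancelʳ (0<ι (suc (suc i))) (begin
      T⁺ (suc (suc i)) * ι (suc (suc i))                      ≡⟨ expTerm-suc (y + u) (suc i) ⟩
      (y + u) * T⁺ (suc i)                                    ≡⟨ *-distribʳ-+ (T⁺ (suc i)) y u ⟩
      y * T⁺ (suc i) + u * T⁺ (suc i)                         ≤⟨ +-monoˡ-≤ _ (*-monoˡ 0≤y (expTerm-shift-≤ i)) ⟩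
      y * (T (suc i) + u * T⁺ i) + u * T⁺ (suc i)             ≡⟨ cong (λ e → e + u * T⁺ (suc i)) (*-distribˡ-+ y (T (suc i)) (u * T⁺ i)) ⟩
      y * T (suc i) + y * (u * T⁺ i) + u * T⁺ (suc i)         ≤⟨ +-monoˡ-≤ (u * T⁺ (suc i)) (+-monoʳ-≤ (y * T (suc i)) (*-monoʳ (0≤* 0≤u (0≤expTerm 0≤y+u i)) y≤y+u)) ⟩
      y * T (suc i) + (y + u) * (u * T⁺ i) + u * T⁺ (suc i)
        ≡⟨ cong₂ (λ a b → a + b + u * T⁺ (suc i)) (sym (expTerm-suc y (suc i)))
             (trans (solve 3 (λ x u t → x :* (u :* t) := u :* (x :* t)) refl (y + u) u (T⁺ i)) (cong (u *_) (sym (expTerm-suc (y + u) i)))) ⟩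
      T (suc (suc i)) * ι (suc (suc i)) + u * (T⁺ (suc i) * ι (suc i)) + u * T⁺ (suc i)
        ≡⟨ cong (λ e → T (suc (suc i)) * e + u * (T⁺ (suc i) * ι (suc i)) + u * T⁺ (suc i)) (ι-suc (suc i)) ⟩
      T (suc (suc i)) * (ι (suc i) + 1ℚ) + u * (T⁺ (suc i) * ι (suc i)) + u * T⁺ (suc i)
        ≡⟨ solve 4 (λ a u t n → a :* (n :+ con 1ℚ) :+ u :* (t :* n) :+ u :* t := (a :+ u :* t) :* (n :+ con 1ℚ)) refl (T (suc (suc i))) u (T⁺ (suc i)) (ι (suc i)) ⟩
      (T (suc (suc i)) + u * T⁺ (suc i)) * (ι (suc i) + 1ℚ)   ≡⟨ cong ((T (suc (suc i)) + u * T⁺ (suc i)) *_) (ι-suc (suc i)) ⟨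
      (T (suc (suc i)) + u * T⁺ (suc i)) * ι (suc (suc i))    ∎)
      where open ≤-Reasoning

    expTerm-shift-≥ : ∀ i → T (suc i) + u * T i ≤ T⁺ (suc i)
    expTerm-shift-≥ zero = ≤-reflexive (solve 2 (λ y u → con 1ℚ :* y :* con 1ℚ :+ u :* con 1ℚ := con 1ℚ :* (y :+ u) :* con 1ℚ) refl y u)
    expTerm-shift-≥ (suc i) = *-cancelʳ (0<ι (suc (suc i))) (begin
      (T (suc (suc i)) + u * T (suc i)) * ι (suc (suc i))    ≡⟨ cong ((T (suc (suc i)) + u * T (suc i)) *_) (ι-suc (suc i)) ⟩
      (T (suc (suc i)) + u * T (suc i)) * (ι (suc i) + 1ℚ)
        ≡⟨ solve 4 (λ a u t n → (a :+ u :* t) :* (n :+ con 1ℚ) := a :* (n :+ con 1ℚ) :+ u :* (t :* n) :+ u :* t) refl (T (suc (suc i))) u (T (suc i)) (ι (suc i)) ⟩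
      T (suc (suc i)) * (ι (suc i) + 1ℚ) + u * (T (suc i) * ι (suc i)) + u * T (suc i)
        ≡⟨ cong (λ e → T (suc (suc i)) * e + u * (T (suc i) * ι (suc i)) + u * T (suc i)) (sym (ι-suc (suc i))) ⟩
      T (suc (suc i)) * ι (suc (suc i)) + u * (T (suc i) * ι (suc i)) + u * T (suc i)
        ≡⟨ cong₂ (λ a b → a + u * b + u * T (suc i)) (expTerm-suc y (suc i)) (expTerm-suc y i) ⟩
      y * T (suc i) + u * (y * T i) + u * T (suc i)
        ≡⟨ solve 4 (λ y u t t′ → y :* t :+ u :* (y :* t′) :+ u :* t := y :* (t :+ u :* t′) :+ u :* t) refl y u (T (suc i)) (T i) ⟩
      y * (T (suc i) + u * T i) + u * T (suc i)              ≤⟨ +-mono-≤ (*-monoˡ 0≤y (expTerm-shift-≥ i)) (*-monoˡ 0≤u (expTerm-mono 0≤y y≤y+u (suc i))) ⟩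
      y * T⁺ (suc i) + u * T⁺ (suc i)                        ≡⟨ *-distribʳ-+ (T⁺ (suc i)) y u ⟨
      (y + u) * T⁺ (suc i)                                   ≡⟨ expTerm-suc (y + u) (suc i) ⟨
      T⁺ (suc (suc i)) * ι (suc (suc i))                     ∎)
      where open ≤-Reasoning

    -- The truncated form of e^(y+u) - e^y ≤ u e^(y+u); the derivative of a partial sum has one term
    -- fewer.
    expPartial-shift-≤ : ∀ N → expPartial (y + u) (suc N) ≤ expPartial y (suc N) + u * expPartial (y + u) N
    expPartial-shift-≤ zero = ≤-reflexive (sym (trans (cong (λ e → 0ℚ + 1ℚ + e) (*-zeroʳ u)) (+-identityʳ (0ℚ + 1ℚ))))
    expPartial-shift-≤ (suc N) = ≤-trans (+-mono-≤ (expPartial-shift-≤ N) (expTerm-shift-≤ N))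
      (≤-reflexive (solve 5 (λ a b c d u → (a :+ u :* b) :+ (c :+ u :* d) := (a :+ c) :+ u :* (b :+ d)) refl (expPartial y (suc N)) (expPartial (y + u) N) (T (suc N)) (T⁺ N) u))

    expPartial-shift-≥ : ∀ N → expPartial y (suc N) + u * expPartial y N ≤ expPartial (y + u) (suc N)
    expPartial-shift-≥ zero = ≤-reflexive (trans (cong (λ e → 0ℚ + 1ℚ + e) (*-zeroʳ u)) (+-identityʳ (0ℚ + 1ℚ)))
    expPartial-shift-≥ (suc N) = ≤-trans
      (≤-reflexive (solve 5 (λ a b c d u → (a :+ c) :+ u :* (b :+ d) := (a :+ u :* b) :+ (c :+ u :* d)) refl (expPartial y (suc N)) (expPartial y N) (T (suc N)) (T N) u))
      (+-mono-≤ (expPartial-shift-≥ N) (expTerm-shift-≥ N))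

  expPartial-step : ∀ {x} → 0ℚ ≤ x → ∀ N → expPartial x N ≤ expPartial x (suc N)
  expPartial-step {x} 0≤x N = subst (_≤ expPartial x (suc N)) (+-identityʳ _) (+-monoʳ-≤ (expPartial x N) (0≤expTerm 0≤x N))

  expPartial-0-≤1 : ∀ N → expPartial 0ℚ N ≤ 1ℚ
  expPartial-0-≤1 zero = 0≤ι 1
  expPartial-0-≤1 (suc zero) = ≤-refl
  expPartial-0-≤1 (suc (suc N)) = subst (_≤ 1ℚ) (sym (trans (cong (λ e → expPartial 0ℚ (suc N) + e)
    (trans (cong (_* (+ 1 / suc N)) (*-zeroʳ (expTerm 0ℚ N))) (*-zeroˡ (+ 1 / suc N)))) (+-identityʳ _))) (expPartial-0-≤1 (suc N))

  0≤reciprocal : ∀ i → 0ℚ ≤ + 1 / suc i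
  0≤reciprocal i = *-cancelʳ (0<ι (suc i)) (subst₂ _≤_ (sym (*-zeroˡ (ι (suc i)))) (sym (reciprocal i)) (0≤ι 1))

  -- e^{n/(κ+1)} ≤ ((κ+1)/κ)^n
  exp-upper : ∀ κ n N → ι (κ ℕ.^ n) * expPartial (ι n * (+ 1 / suc κ)) N ≤ ι (suc κ ℕ.^ n)
  exp-upper κ zero N = subst (λ x → 1ℚ * expPartial x N ≤ 1ℚ) (sym (*-zeroˡ (+ 1 / suc κ))) (subst (_≤ 1ℚ) (sym (*-identityˡ _)) (expPartial-0-≤1 N))
  exp-upper κ (suc n) N = begin
    ι (κ ℕ.* κ ℕ.^ n) * expPartial (ι (suc n) * u) N
      ≡⟨ cong₂ (λ a b → a * expPartial b N) (ι-* κ (κ ℕ.^ n)) (trans (cong (_* u) (ι-suc n)) (trans (*-distribʳ-+ u (ι n) 1ℚ) (cong (λ e → y + e) (*-identityˡ u)))) ⟩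
    ι κ * ι (κ ℕ.^ n) * expPartial (y + u) N        ≡⟨ solve 3 (λ a b c → a :* b :* c := b :* (a :* c)) refl (ι κ) (ι (κ ℕ.^ n)) (expPartial (y + u) N) ⟩
    ι (κ ℕ.^ n) * (ι κ * expPartial (y + u) N)      ≤⟨ *-monoˡ (0≤ι (κ ℕ.^ n)) (shrink N) ⟩
    ι (κ ℕ.^ n) * (ι (suc κ) * expPartial y N)      ≡⟨ solve 3 (λ a b c → b :* (a :* c) := a :* (b :* c)) refl (ι (suc κ)) (ι (κ ℕ.^ n)) (expPartial y N) ⟩
    ι (suc κ) * (ι (κ ℕ.^ n) * expPartial y N)      ≤⟨ *-monoˡ (0≤ι (suc κ)) (exp-upper κ n N) ⟩
    ι (suc κ) * ι (suc κ ℕ.^ n)                     ≡⟨ ι-* (suc κ) (suc κ ℕ.^ n) ⟨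
    ι (suc κ ℕ.^ suc n)                             ∎
    where
    open ≤-Reasoning
    u y : ℚ
    u = + 1 / suc κ
    y = ι n * u
    0≤u : 0ℚ ≤ u
    0≤u = 0≤reciprocal κ
    0≤y : 0ℚ ≤ y
    0≤y = 0≤* (0≤ι n) 0≤u
    -- This is (1 - u) e^(y+u) ≤ e^y for u = 1/(κ + 1), scaled by κ + 1 and proved with `X` added to
    -- both sides.
    shrink : ∀ N → ι κ * expPartial (y + u) N ≤ ι (suc κ) * expPartial y N
    shrink zero = ≤-reflexive (trans (*-zeroʳ (ι κ)) (sym (*-zeroʳ (ι (suc κ)))))
    shrink (suc N) = +-cancelʳ-≤′ X (begin
      ι κ * X + X                            ≡⟨ solve 2 (λ k x → k :* x :+ x := (k :+ con 1ℚ) :* x) refl (ι κ) X ⟩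
      (ι κ + 1ℚ) * X                         ≡⟨ cong (_* X) (ι-suc κ) ⟨
      ι (suc κ) * X                          ≤⟨ *-monoˡ (0≤ι (suc κ)) (expPartial-shift-≤ 0≤y 0≤u N) ⟩
      ι (suc κ) * (Y + u * expPartial (y + u) N) ≤⟨ *-monoˡ (0≤ι (suc κ)) (+-monoʳ-≤ Y (*-monoˡ 0≤u (expPartial-step (+-mono-≤ 0≤y 0≤u) N))) ⟩
      ι (suc κ) * (Y + u * X)                ≡⟨ solve 4 (λ k y u x → k :* (y :+ u :* x) := k :* y :+ u :* k :* x) refl (ι (suc κ)) Y u X ⟩
      ι (suc κ) * Y + u * ι (suc κ) * X      ≡⟨ cong (λ e → ι (suc κ) * Y + e * X) (reciprocal κ) ⟩
      ι (suc κ) * Y + 1ℚ * X                 ≡⟨ cong (λ e → ι (suc κ) * Y + e) (*-identityˡ X) ⟩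
      ι (suc κ) * Y + X                      ∎)
      where
      X Y : ℚ
      X = expPartial (y + u) (suc N)
      Y = expPartial y (suc N)
      +-cancelʳ-≤′ : ∀ {p q} r → p + r ≤ q + r → p ≤ q
      +-cancelʳ-≤′ {p} {q} r p+r≤q+r = subst₂ _≤_ (undo p) (undo q) (+-monoˡ-≤ (- r) p+r≤q+r)
        where
        undo : ∀ p → p + r + (- r) ≡ p
        undo p = trans (+-assoc p r (- r)) (trans (cong (λ e → p + e) (+-inverseʳ r)) (+-identityʳ p))

  -- (1 + 1/κ)^n ≤ e^{n/κ}
  exp-lower : ∀ κ′ n → let κ = suc κ′ in ι (suc κ ℕ.^ n) ≤ ι (κ ℕ.^ n) * expPartial (ι n * (+ 1 / κ)) (suc n)
  exp-lower κ′ zero = ≤-refl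
  exp-lower κ′ (suc n) = begin
    ι (suc κ ℕ.^ suc n)                                ≡⟨ ι-* (suc κ) (suc κ ℕ.^ n) ⟩
    ι (suc κ) * ι (suc κ ℕ.^ n)                        ≤⟨ *-monoˡ (0≤ι (suc κ)) (exp-lower κ′ n) ⟩
    ι (suc κ) * (ι (κ ℕ.^ n) * Y)                      ≡⟨ cong (_* (ι (κ ℕ.^ n) * Y)) (ι-suc κ) ⟩
    (ι κ + 1ℚ) * (ι (κ ℕ.^ n) * Y)                     ≡⟨ cong (λ e → (ι κ + e) * (ι (κ ℕ.^ n) * Y)) (sym (reciprocal κ′)) ⟩
    (ι κ + u * ι κ) * (ι (κ ℕ.^ n) * Y)                ≡⟨ solve 4 (λ k u p y → (k :+ u :* k) :* (p :* y) := k :* p :* (y :+ u :* y)) refl (ι κ) u (ι (κ ℕ.^ n)) Y ⟩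
    -- The factor 1 + u costs one more term of the series, hence `suc n` terms after `n` factors.
    ι κ * ι (κ ℕ.^ n) * (Y + u * Y)                    ≤⟨ *-monoˡ (0≤* (0≤ι κ) (0≤ι (κ ℕ.^ n))) (≤-trans (+-monoˡ-≤ (u * Y) (expPartial-step 0≤y (suc n))) (expPartial-shift-≥ 0≤y 0≤u (suc n))) ⟩
    ι κ * ι (κ ℕ.^ n) * expPartial (y + u) (suc (suc n))
      ≡⟨ cong₂ (λ a b → a * expPartial b (suc (suc n))) (sym (ι-* κ (κ ℕ.^ n))) (sym (trans (cong (_* u) (ι-suc n)) (trans (*-distribʳ-+ u (ι n) 1ℚ) (cong (λ e → y + e) (*-identityˡ u))))) ⟩
    ι (κ ℕ.^ suc n) * expPartial (ι (suc n) * u) (suc (suc n)) ∎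
    where
    open ≤-Reasoning
    κ = suc κ′
    u y Y : ℚ
    u = + 1 / κ
    y = ι n * u
    Y = expPartial y (suc n)
    0≤u : 0ℚ ≤ u
    0≤u = 0≤reciprocal κ′
    0≤y : 0ℚ ≤ y
    0≤y = 0≤* (0≤ι n) 0≤u

  ÷'-* : ∀ p {q} → 0ℚ < q → (p ÷' q) * q ≡ p
  ÷'-* p {q} 0<q with q ≟ 0ℚ
  ... | yes q≡0 = contradiction (sym q≡0) (<⇒≢ 0<q)
  ... | no q≢0 = trans (*-assoc p _ q) (trans (cong (p *_) (*-inverseˡ q {{≢-nonZero q≢0}})) (*-identityʳ p))

  -- The denominator of `ε` serves, its numerator being at least 1.
  archimedean : ∀ ε → 0ℚ < ε → ∃ λ d′ → 1ℚ ≤ ε * ι (suc d′)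
  archimedean ε 0<ε = bound ε (positive 0<ε)
    where
    bound : ∀ ε → Positive ε → ∃ λ d′ → 1ℚ ≤ ε * ι (suc d′)
    bound ε@(mkℚ (+ suc n) d′ _) _ = d′ , subst (_≤ ε * ι (suc d′)) (reciprocal d′) (*-monoʳ (0≤ι (suc d′))
      (toℚᵘ-cancel-≤ (ℚᵘ.≤-respˡ-≃ (ℚᵘ.≃-sym (toℚᵘ-fromℚᵘ (ℚᵘ.mkℚᵘ (+ 1) d′)))
        (ℚᵘ.*≤* (ℤ.*-monoʳ-≤-nonNeg (+ suc d′) (ℤ.+≤+ (ℕ.s≤s (ℕ.z≤n {n}))))))))

  0<* : ∀ {p q} → 0ℚ < p → 0ℚ < q → 0ℚ < p * q
  0<* {p} {q} 0<p 0<q = positive⁻¹ (p * q) {{pos*pos⇒pos p {{positive 0<p}} q {{positive 0<q}}}}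

  ι-*₃ : ∀ a b c → ι (a ℕ.* b ℕ.* c) ≡ ι a * ι b * ι c
  ι-*₃ a b c = trans (ι-* (a ℕ.* b) c) (cong (_* ι c) (ι-* a b))

  -- The rational `c` enters only through the fraction a/d ≤ c, so that after cross-multiplication
  -- an inequality between naturals suffices.
  ÷'-≤ : ∀ s n b {c} k d a → 0ℚ < c → .{{ℕ.NonZero k}} → .{{ℕ.NonZero d}} → ι a ≤ c * ι d →
         s ℕ.* suc b ℕ.* d ℕ.≤ n ℕ.* a ℕ.* k → ι s ÷' (c * ι k) ≤ ι n * (+ 1 / suc b)
  ÷'-≤ s n b {c} k d a 0<c a≤cd bound = *-cancelʳ (0<* 0<c (0<ι k)) (*-cancelʳ (0<* (0<ι (suc b)) (0<ι d)) (begin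
    ι s ÷' (c * ι k) * (c * ι k) * (ι (suc b) * ι d)   ≡⟨ cong (_* (ι (suc b) * ι d)) (÷'-* (ι s) (0<* 0<c (0<ι k))) ⟩
    ι s * (ι (suc b) * ι d)                            ≡⟨ *-assoc (ι s) (ι (suc b)) (ι d) ⟨
    ι s * ι (suc b) * ι d                              ≡⟨ ι-*₃ s (suc b) d ⟨
    ι (s ℕ.* suc b ℕ.* d)                              ≤⟨ ι-mono {s ℕ.* suc b ℕ.* d} {n ℕ.* a ℕ.* k} bound ⟩
    ι (n ℕ.* a ℕ.* k)                                  ≡⟨ ι-*₃ n a k ⟩
    ι n * ι a * ι k                                    ≤⟨ *-monoʳ (0≤ι k) (*-monoˡ (0≤ι n) a≤cd) ⟩
    ι n * (c * ι d) * ι k                              ≡⟨ cong (λ e → ι n * (c * e) * ι k) (*-identityˡ (ι d)) ⟨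
    ι n * (c * (1ℚ * ι d)) * ι k                       ≡⟨ cong (λ e → ι n * (c * (e * ι d)) * ι k) (reciprocal b) ⟨
    ι n * (c * (u * ι (suc b) * ι d)) * ι k            ≡⟨ solve 6 (λ n c u b d k → n :* (c :* (u :* b :* d)) :* k := n :* u :* (c :* k) :* (b :* d)) refl (ι n) c u (ι (suc b)) (ι d) (ι k) ⟩
    ι n * u * (c * ι k) * (ι (suc b) * ι d)            ∎))
    where
    open ≤-Reasoning
    u : ℚ
    u = + 1 / suc b

  ≤-÷' : ∀ s n b {c} k d a → 0ℚ < c → .{{ℕ.NonZero k}} → .{{ℕ.NonZero d}} → c * ι d ≤ ι a →
         n ℕ.* a ℕ.* k ℕ.≤ s ℕ.* d ℕ.* suc b → ι n * (+ 1 / suc b) ≤ ι s ÷' (c * ι k)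
  ≤-÷' s n b {c} k d a 0<c cd≤a bound = *-cancelʳ (0<* 0<c (0<ι k)) (*-cancelʳ (0<* (0<ι (suc b)) (0<ι d)) (begin
    ι n * u * (c * ι k) * (ι (suc b) * ι d)            ≡⟨ solve 6 (λ n c u b d k → n :* u :* (c :* k) :* (b :* d) := n :* (c :* (u :* b :* d)) :* k) refl (ι n) c u (ι (suc b)) (ι d) (ι k) ⟩
    ι n * (c * (u * ι (suc b) * ι d)) * ι k            ≡⟨ cong (λ e → ι n * (c * (e * ι d)) * ι k) (reciprocal b) ⟩
    ι n * (c * (1ℚ * ι d)) * ι k                       ≡⟨ cong (λ e → ι n * (c * e) * ι k) (*-identityˡ (ι d)) ⟩
    ι n * (c * ι d) * ι k                              ≤⟨ *-monoʳ (0≤ι k) (*-monoˡ (0≤ι n) cd≤a) ⟩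
    ι n * ι a * ι k                                    ≡⟨ ι-*₃ n a k ⟨
    ι (n ℕ.* a ℕ.* k)                                  ≤⟨ ι-mono {n ℕ.* a ℕ.* k} {s ℕ.* d ℕ.* suc b} bound ⟩
    ι (s ℕ.* d ℕ.* suc b)                              ≡⟨ ι-*₃ s d (suc b) ⟩
    ι s * ι d * ι (suc b)                              ≡⟨ solve 3 (λ s d b → s :* d :* b := s :* (b :* d)) refl (ι s) (ι d) (ι (suc b)) ⟩
    ι s * (ι (suc b) * ι d)                            ≡⟨ cong (_* (ι (suc b) * ι d)) (÷'-* (ι s) (0<* 0<c (0<ι k))) ⟨
    ι s ÷' (c * ι k) * (c * ι k) * (ι (suc b) * ι d)   ∎))
    where
    open ≤-Reasoning
    u : ℚ
    u = + 1 / suc b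

  0≤÷' : ∀ s {q} → 0ℚ < q → 0ℚ ≤ ι s ÷' q
  0≤÷' s {q} 0<q = *-cancelʳ 0<q (subst₂ _≤_ (sym (*-zeroˡ q)) (sym (÷'-* (ι s) 0<q)) (0≤ι s))

  -- With c = 1 + ε ≥ (d + 1)/d, the exponent s/(c k) is at most n/(κ + 1), and e^(n/(κ+1)) ≤ ((κ +
  -- 1)/κ)^n ≤ m.
  LeCKlnM-intro : ∀ {s k m} ε d n κ → 0ℚ < ε → 1ℚ ≤ ε * ι d → .{{ℕ.NonZero k}} → .{{ℕ.NonZero d}} → .{{ℕ.NonZero κ}} →
    suc κ ℕ.^ n ℕ.≤ m ℕ.* κ ℕ.^ n → s ℕ.* suc κ ℕ.* d ℕ.≤ n ℕ.* suc d ℕ.* k → LeCKlnM s (1ℚ + ε) k m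
  LeCKlnM-intro {s} {k} {m} ε d n κ 0<ε 1≤εd growth ratio N = *-cancelʳ (0<ι (κ ℕ.^ n) {{ℕ.m^n≢0 κ n}}) (begin
    expPartial x N * ι (κ ℕ.^ n)         ≡⟨ *-comm (expPartial x N) _ ⟩
    ι (κ ℕ.^ n) * expPartial x N         ≤⟨ *-monoˡ (0≤ι (κ ℕ.^ n)) (expPartial-mono (0≤÷' s (0<* 0<c (0<ι k))) (÷'-≤ s n κ k d (suc d) 0<c a≤cd ratio) N) ⟩
    ι (κ ℕ.^ n) * expPartial (ι n * (+ 1 / suc κ)) N ≤⟨ exp-upper κ n N ⟩
    ι (suc κ ℕ.^ n)                      ≤⟨ ι-mono {suc κ ℕ.^ n} {m ℕ.* κ ℕ.^ n} growth ⟩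
    ι (m ℕ.* κ ℕ.^ n)                    ≡⟨ ι-* m (κ ℕ.^ n) ⟩
    ι m * ι (κ ℕ.^ n)                    ∎)
    where
    open ≤-Reasoning
    x = ι s ÷' ((1ℚ + ε) * ι k)
    0<c : 0ℚ < 1ℚ + ε
    0<c = +-mono-≤-< (0≤ι 1) 0<ε
    a≤cd : ι (suc d) ≤ (1ℚ + ε) * ι d
    a≤cd = begin
      ι (suc d)            ≡⟨ ι-suc d ⟩
      ι d + 1ℚ             ≤⟨ +-monoʳ-≤ (ι d) 1≤εd ⟩
      ι d + ε * ι d        ≡⟨ solve 2 (λ d e → d :+ e :* d := (con 1ℚ :+ e) :* d) refl (ι d) ε ⟩
      (1ℚ + ε) * ι d       ∎

  -- With c = 1 - ε ≤ (d - 1)/d, the exponent s/(c k) is at least n/κ, and n + 1 terms of the series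
  -- at n/κ already reach ((κ + 1)/κ)^n ≥ m.
  CKlnMLe-intro : ∀ {s k m} ε d′ n κ′ → let d = suc d′; κ = suc κ′ in
    0ℚ < 1ℚ - ε → 1ℚ ≤ ε * ι d → .{{ℕ.NonZero k}} →
    m ℕ.* κ ℕ.^ n ℕ.≤ suc κ ℕ.^ n → n ℕ.* d′ ℕ.* k ℕ.≤ s ℕ.* d ℕ.* κ → CKlnMLe (1ℚ - ε) k m s
  CKlnMLe-intro {s} {k} {m} ε d′ n κ′ 0<c 1≤εd growth ratio = suc n , *-cancelʳ (0<ι (κ ℕ.^ n) {{ℕ.m^n≢0 κ n}}) (begin
    ι m * ι (κ ℕ.^ n)                    ≡⟨ ι-* m (κ ℕ.^ n) ⟨
    ι (m ℕ.* κ ℕ.^ n)                    ≤⟨ ι-mono {m ℕ.* κ ℕ.^ n} {suc κ ℕ.^ n} growth ⟩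
    ι (suc κ ℕ.^ n)                      ≤⟨ exp-lower κ′ n ⟩
    ι (κ ℕ.^ n) * expPartial (ι n * (+ 1 / κ)) (suc n)
      ≤⟨ *-monoˡ (0≤ι (κ ℕ.^ n)) (expPartial-mono (0≤* (0≤ι n) (0≤reciprocal κ′)) (≤-÷' s n κ′ k (suc d′) d′ 0<c cd≤a ratio) (suc n)) ⟩
    ι (κ ℕ.^ n) * expPartial x (suc n)   ≡⟨ *-comm _ (expPartial x (suc n)) ⟩
    expPartial x (suc n) * ι (κ ℕ.^ n)   ∎)
    where
    open ≤-Reasoning
    κ = suc κ′
    x = ι s ÷' ((1ℚ - ε) * ι k)
    cd≤a : (1ℚ - ε) * ι (suc d′) ≤ ι d′
    cd≤a = begin
      (1ℚ - ε) * ι (suc d′)                         ≡⟨ solve 2 (λ d e → (con 1ℚ :+ (:- e)) :* d := d :+ (:- (e :* d))) refl (ι (suc d′)) ε ⟩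
      ι (suc d′) + (- (ε * ι (suc d′)))             ≤⟨ +-monoʳ-≤ (ι (suc d′)) (neg-antimono-≤ 1≤εd) ⟩
      ι (suc d′) + (- 1ℚ)                           ≡⟨ cong (_+ (- 1ℚ)) (ι-suc d′) ⟩
      ι d′ + 1ℚ + (- 1ℚ)                            ≡⟨ solve 1 (λ d → d :+ con 1ℚ :+ con (- 1ℚ) := d) refl (ι d′) ⟩
      ι d′                                          ∎

-- Assembly of the two bounds

open import Data.Nat using (ℕ; _≥_)
open import Data.Product using (Σ; _×_; ∃)
open import Data.Rational using (ℚ; 0ℚ; 1ℚ; _<_; _+_; _-_)
import Data.Nat as ℕ
import Data.Nat.Properties as ℕ
open import Data.Product using (_,_)
open ListColourings using (choice-number-lower; choice-number-upper)
open Exponential using (archimedean; CKlnMLe-intro; LeCKlnM-intro)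

theorem3p1 : (ε : ℚ) → 0ℚ < ε →
    ∃ λ (N : ℕ) → (m k : ℕ) → m ≥ N → k ≥ N →
    ((0ℚ < 1ℚ - ε) → (s : ℕ) → Choosable (KAdj m k) s → CKlnMLe (1ℚ - ε) k m s)
    ×
    (∃ λ (s : ℕ) → Choosable (KAdj m k) s × LeCKlnM s (1ℚ + ε) k m)
theorem3p1 ε 0<ε with archimedean ε 0<ε
... | d′ , 1≤εd = combine (choice-number-lower d′) (choice-number-upper d′)
  where
  d κ₁ : ℕ
  d = ℕ.suc d′
  κ₁ = 8 ℕ.* d
  combine : (∃ λ N → ∀ m k → N ℕ.≤ m → N ℕ.≤ k → ∀ s → Choosable (KAdj m k) s →
               ∃ λ n → m ℕ.* κ₁ ℕ.^ n ℕ.≤ ℕ.suc κ₁ ℕ.^ n × n ℕ.* d′ ℕ.* k ℕ.≤ s ℕ.* d ℕ.* κ₁) →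
            (∃ λ N → ∀ m k → N ℕ.≤ m → N ℕ.≤ k → ∃ λ s → ∃ λ n → ∃ λ κ′ → let κ = ℕ.suc κ′ in
               Choosable (KAdj m k) s × ℕ.suc κ ℕ.^ n ℕ.≤ m ℕ.* κ ℕ.^ n × s ℕ.* ℕ.suc κ ℕ.* d ℕ.≤ n ℕ.* ℕ.suc d ℕ.* k) →
            ∃ λ (N : ℕ) → (m k : ℕ) → m ≥ N → k ≥ N →
              ((0ℚ < 1ℚ - ε) → (s : ℕ) → Choosable (KAdj m k) s → CKlnMLe (1ℚ - ε) k m s)
              ×
              (∃ λ (s : ℕ) → Choosable (KAdj m k) s × LeCKlnM s (1ℚ + ε) k m)
  -- The successor keeps `k` nonzero, as division by `k` requires.
  combine (N₁ , lower) (N₂ , upper) = ℕ.suc (N₁ ℕ.+ N₂) , bounds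
    where
    bounds : (m k : ℕ) → m ≥ ℕ.suc (N₁ ℕ.+ N₂) → k ≥ ℕ.suc (N₁ ℕ.+ N₂) → _
    bounds m k m≥N k≥N = lower-bound , upper-bound (upper m k (N₂≤ m≥N) (N₂≤ k≥N))
      where
      N₁≤ : ∀ {x} → x ≥ ℕ.suc (N₁ ℕ.+ N₂) → N₁ ℕ.≤ x
      N₁≤ = ℕ.≤-trans (ℕ.≤-trans (ℕ.m≤m+n N₁ N₂) (ℕ.n≤1+n _))
      N₂≤ : ∀ {x} → x ≥ ℕ.suc (N₁ ℕ.+ N₂) → N₂ ℕ.≤ x
      N₂≤ = ℕ.≤-trans (ℕ.≤-trans (ℕ.m≤n+m N₂ N₁) (ℕ.n≤1+n _))
      k≢0 : ℕ.NonZero k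
      k≢0 = ℕ.>-nonZero (ℕ.≤-trans (ℕ.s≤s ℕ.z≤n) k≥N)
      lower-bound : (0ℚ < 1ℚ - ε) → (s : ℕ) → Choosable (KAdj m k) s → CKlnMLe (1ℚ - ε) k m s
      lower-bound 0<1-ε s choosable with lower m k (N₁≤ m≥N) (N₁≤ k≥N) s choosable
      -- `d′ + 7 * d` is the predecessor of `κ₁`, to which its successor is definitionally equal.
      ... | n , growth , ratio = CKlnMLe-intro {s} {k} {m} ε d′ n (d′ ℕ.+ 7 ℕ.* d) 0<1-ε 1≤εd {{k≢0}} growth ratio
      upper-bound : _ → ∃ λ (s : ℕ) → Choosable (KAdj m k) s × LeCKlnM s (1ℚ + ε) k m
      upper-bound (s , n , κ′ , choosable , growth , ratio) =
        s , choosable , LeCKlnM-intro {s} {k} {m} ε d n (ℕ.suc κ′) 0<ε 1≤εd {{k≢0}} growth ratio
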